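{- Let $\mathcal{I}$ be a finite sets interpretation whose output signature contains a binary symbol $\sim$. Then there exists a finite sets interpretation $\mathcal{I}'$ such that for every tree $t$ (over the input signature of $\mathcal{I}$) for which the interpretation of $\sim$ in $\mathcal{I}(t)$ is a congruence, the structure $\mathcal{I}'(t)$ is isomorphic to the quotient $\mathcal{I}(t)/_{\sim}$.
   Context: A tree labeled by a finite alphabet $\Sigma$ is a partial mapping $t:\{0,1\}^*\to\Sigma$ with prefix-closed domain $\mathit{dom}(t)$ such that $u1\in\mathit{dom}(t)$ implies $u0\in\mathit{dom}(t)$. As a structure, $t$ has universe $\mathit{dom}(t)$, binary relations $S_0,S_1$ with $S_i(u,v)$ iff $v=ui$, and for each $a\in\Sigma$ a unary predicate for $\{u:t(u)=a\}$. WMSO is MSO with set variables ranging over finite sets. A finite sets interpretation is a tuple $(\delta,\Phi_{R_1},\dots,\Phi_{R_N})$ of WMSO formulas, $\delta$ with one free set variable and $\Phi_{R_i}$ with $r_i$ free set variables; $\mathcal{I}(\mathcal{S})$ has as universe the finite subsets $U$ of the universe of $\mathcal{S}$ with $\mathcal{S}\models\delta(U)$, and $R_i$ is interpreted as the tuples of such sets satisfying $\Phi_{R_i}$ in $\mathcal{S}$. A congruence on a structure is an equivalence relation $\sim$ such that for every relation symbol $R$ of arity $n$, $x_1\sim y_1,\dots,x_n\sim y_n$ implies ($R(x_1,\dots,x_n)$ iff $R(y_1,\dots,y_n)$). The quotient $\mathcal{S}/_\sim$ has as elements the $\sim$-classes, and its relations are the images of those of $\mathcal{S}$ under the canonical surjection.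 -}

module Defs where

open import Level using (0ℓ)
open import Data.Bool using (Bool; true; false)
open import Data.Nat using (ℕ; zero; suc)
open import Data.Fin using (Fin; zero; suc)
open import Data.List using (List; []; _∷_; _++_)
open import Data.List.Membership.Propositional using (_∈_)
open import Data.List.Relation.Unary.All using (All)
open import Data.Maybe using (Maybe; just; nothing)
open import Data.Product using (Σ; _×_; _,_; proj₁)
open import Data.Empty using (⊥)
open import Relation.Nullary using (¬_)
open import Relation.Binary.PropositionalEquality using (_≡_; subst)
open import Relation.Binary.Structures using (IsEquivalence)
open import Function.Bundles using (_⇔_)
import Data.Vec.Functional as VF

-- Trees over the finite alphabet Fin k.
-- Nodes are words over {0,1}; false = 0, true = 1.

Node : Set
Node = List Bool

child : Node → Bool → Node
child u b = u ++ (b ∷ [])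

record Tree (k : ℕ) : Set where
  field
    label : Node → Maybe (Fin k)
  InDom : Node → Set
  InDom u = Σ (Fin k) λ a → label u ≡ just a
  field
    prefix-closed : ∀ u b → InDom (child u b) → InDom u
    left-sibling  : ∀ u → InDom (child u true) → InDom (child u false)

open Tree public

-- WMSO over trees: m first-order variables and n set variables in scope
-- (de Bruijn indices).

data Form (k : ℕ) : ℕ → ℕ → Set where
  lab  : ∀ {m n} → Fin k → Fin m → Form k m n
  succ : ∀ {m n} → Bool → Fin m → Fin m → Form k m n
  eqv  : ∀ {m n} → Fin m → Fin m → Form k m n
  mem  : ∀ {m n} → Fin m → Fin n → Form k m n
  neg  : ∀ {m n} → Form k m n → Form k m n
  and  : ∀ {m n} → Form k m n → Form k m n → Form k m n
  ex1  : ∀ {m n} → Form k (suc m) n → Form k m n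
  ex2  : ∀ {m n} → Form k m (suc n) → Form k m n

-- Satisfaction; FO variables range over dom(t), set variables over
-- finite subsets of dom(t) (given as lists).
Sat : ∀ {k m n} → Form k m n → Tree k → (Fin m → Node) → (Fin n → List Node) → Set
Sat (lab a x)    t ρ σ = label t (ρ x) ≡ just a
Sat (succ b x y) t ρ σ = ρ y ≡ child (ρ x) b
Sat (eqv x y)    t ρ σ = ρ x ≡ ρ y
Sat (mem x X)    t ρ σ = ρ x ∈ σ X
Sat (neg φ)      t ρ σ = ¬ Sat φ t ρ σ
Sat (and φ ψ)    t ρ σ = Sat φ t ρ σ × Sat ψ t ρ σ
Sat (ex1 φ)      t ρ σ = Σ Node λ u → InDom t u × Sat φ t (u VF.∷ ρ) σ
Sat (ex2 φ)      t ρ σ = Σ (List Node) λ X → All (InDom t) X × Sat φ t ρ (X VF.∷ σ)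

noFO : Fin 0 → Node
noFO ()

record Sig : Set where
  field
    N  : ℕ
    ar : Fin N → ℕ
open Sig public

record Structure (sig : Sig) : Set₁ where
  field
    Carrier : Set
    _≈_     : Carrier → Carrier → Set      -- equality of elements
    rel     : (i : Fin (N sig)) → (Fin (ar sig i) → Carrier) → Set
open Structure public

record Interp (k : ℕ) (sig : Sig) : Set where
  field
    δ : Form k 0 1
    Φ : (i : Fin (N sig)) → Form k 0 (ar sig i)
open Interp public

FinSub : ∀ {k} → Tree k → Set
FinSub t = Σ (List Node) (All (InDom t))

⟦_⟧ : ∀ {k sig} → Interp k sig → Tree k → Structure sig
⟦ I ⟧ t = record
  { Carrier = Σ (FinSub t) λ U → Sat (δ I) t noFO (λ _ → proj₁ U)
  ; _≈_     = λ U V → ∀ u → (u ∈ proj₁ (proj₁ U)) ⇔ (u ∈ proj₁ (proj₁ V))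
  ; rel     = λ i Us → Sat (Φ I i) t noFO (λ j → proj₁ (proj₁ (Us j)))
  }

BinRel : ∀ {sig} (A : Structure sig) (s : Fin (N sig)) → ar sig s ≡ 2 →
         Carrier A → Carrier A → Set
BinRel A s eq x y = rel A s (λ j → pair (subst Fin eq j))
  where
  pair : Fin 2 → Carrier A
  pair zero    = x
  pair (suc _) = y

record IsCongruence {sig} (A : Structure sig) (E : Carrier A → Carrier A → Set) : Set where
  field
    isEquivalence : IsEquivalence E
    compatible    : ∀ i (xs ys : Fin (ar sig i) → Carrier A) →
                    (∀ j → E (xs j) (ys j)) → rel A i xs ⇔ rel A i ys

-- Quotient A/E: elements are E-classes (presented by representatives,
-- with E as equality); relations are images under the canonical surjection.
Quotient : ∀ {sig} (A : Structure sig) → (Carrier A → Carrier A → Set) → Structure sig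
Quotient {sig} A E = record
  { Carrier = Carrier A
  ; _≈_     = E
  ; rel     = λ i xs → Σ (Fin (ar sig i) → Carrier A) λ ys →
                (∀ j → E (ys j) (xs j)) × rel A i ys
  }

record Iso {sig} (A B : Structure sig) : Set where
  field
    to      : Carrier A → Carrier B
    from    : Carrier B → Carrier A
    to-cong   : ∀ {x y} → _≈_ A x y → _≈_ B (to x) (to y)
    from-cong : ∀ {x y} → _≈_ B x y → _≈_ A (from x) (from y)
    from-to : ∀ x → _≈_ A (from (to x)) x
    to-from : ∀ y → _≈_ B (to (from y)) y
    rel-iso : ∀ i (xs : Fin (ar sig i) → Carrier A) →
              rel A i xs ⇔ rel B i (λ j → to (xs j))

{-# OPTIONS --safe #-}
module Submission where

-- Write X ~ Y for the given relation. A node v is needed for the class of X if every member of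
-- the class has an element in the subtree of v; the needed nodes form a finite prefix-closed set.
-- By a Feferman–Vaught composition argument there is a finite list of formulas such that changing
-- X below a node u that is not needed, without changing the truth values of the list at u, stays in
-- the class: compare both sets with a member of the class that has no element below u.
--
-- A class may have no definable member, so it is coded by a different set. Let the frontier of X
-- consist of the minimal nodes with infinite subtree that are not needed. The code keeps X outside
-- the subtrees of the frontier, and in the subtree of a frontier node u it stores the truth values
-- of the list on the levels below u, followed by an end marker. The end markers make the frontier
-- recoverable, hence the code determines the class. The codes of the members of one class have
-- bounded depth, so there are finitely many, and the lexicographically least one is definable.

open import Defs
open import Level using (0ℓ)
open import Axiom.ExcludedMiddle using (ExcludedMiddle)
open import Data.Bool using (Bool; true; false; f<t)
import Data.Bool as Bool
import Data.Bool.Properties as Bool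
open import Data.Empty using (⊥-elim)
open import Data.Fin using (Fin; zero; suc; lift; _↑ˡ_; _↑ʳ_)
open import Data.List using (List; []; _∷_; _++_; length; map; filter; take)
open import Data.List.Properties using (length-++; length-take)
open import Data.List.Membership.Propositional using (_∈_)
open import Data.List.Membership.Propositional.Properties
  using (∈-map⁺; ∈-map⁻; ∈-++⁺ˡ; ∈-++⁺ʳ; ∈-++⁻; ∈-filter⁺; ∈-filter⁻)
open import Data.List.Relation.Binary.Lex.Strict using (Lex-<; halt; this; next; <-compare; xs≮[])
open import Data.List.Relation.Binary.Pointwise using (Pointwise-≡⇒≡)
open import Data.List.Relation.Binary.Prefix.Heterogeneous using (Prefix; []; _∷_; _++ᵖ_)
import Data.List.Relation.Binary.Prefix.Heterogeneous.Properties as Prefix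
open import Data.List.Relation.Unary.All using (All; []; _∷_)
import Data.List.Relation.Unary.All as All
import Data.List.Relation.Unary.All.Properties as All
open import Data.List.Relation.Unary.AllPairs using (AllPairs; []; _∷_)
import Data.List.Relation.Unary.AllPairs.Properties as AllPairs
open import Data.List.Relation.Unary.Any using (here; there)
open import Data.List.Reverse using (Reverse; []; _∶_∶ʳ_; reverseView)
open import Data.Nat using (ℕ; zero; suc; _+_; _≤_; _<_; _⊔_; z≤n; s≤s)
open import Data.Nat.Properties
open import Data.Product using (Σ; ∃; _×_; _,_; proj₁; proj₂)
open import Data.Sum using (_⊎_; inj₁; inj₂; [_,_]′)
import Data.Vec.Functional as VF
open import Function using (_∘_; id)
open import Function.Bundles using (_⇔_; mk⇔; module Equivalence)
open import Function.Construct.Composition using (_⇔-∘_)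
open import Function.Construct.Identity using (⇔-id)
open import Function.Construct.Symmetry using (⇔-sym)
open import Relation.Binary.Definitions using (tri<; tri≈; tri>)
open import Relation.Binary.PropositionalEquality
  using (_≡_; _≢_; refl; sym; trans; cong; subst; subst₂)
open import Relation.Binary.Structures using (IsEquivalence)
open import Relation.Nullary using (Dec; yes; no; ¬_)
open import Relation.Nullary.Decidable using (decidable-stable)
open Equivalence using (to; from)

-- Words

infix 4 _⊑_ _≺_

_⊑_ : Node → Node → Set
_⊑_ = Prefix _≡_

⊑-refl : ∀ {u} → u ⊑ u
⊑-refl {[]}    = []
⊑-refl {b ∷ u} = refl ∷ ⊑-refl

⊑-trans : ∀ {u v w} → u ⊑ v → v ⊑ w → u ⊑ w
⊑-trans = Prefix.trans trans

⊑-child : ∀ u b → u ⊑ child u b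
⊑-child u b = ⊑-refl ++ᵖ (b ∷ [])

⊑-length⁻ : ∀ {u v} → u ⊑ v → length v ≤ length u → u ≡ v
⊑-length⁻ {v = []}   []         _         = refl
⊑-length⁻            (refl ∷ p) (s≤s v≤u) = cong (_ ∷_) (⊑-length⁻ p v≤u)

⊑-child⁻ : ∀ {v} u {b} → v ⊑ child u b → v ⊑ u ⊎ v ≡ child u b
⊑-child⁻ []      []             = inj₁ []
⊑-child⁻ []      (refl ∷ [])    = inj₂ refl
⊑-child⁻ (_ ∷ u) []             = inj₁ []
⊑-child⁻ (_ ∷ u) (refl ∷ p) with ⊑-child⁻ u p
... | inj₁ q = inj₁ (refl ∷ q)
... | inj₂ e = inj₂ (cong (_ ∷_) e)

⊑-compare : ∀ {u v w} → u ⊑ w → v ⊑ w → u ⊑ v ⊎ v ⊑ u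
⊑-compare []         _          = inj₁ []
⊑-compare (_ ∷ _)    []         = inj₂ []
⊑-compare (refl ∷ p) (refl ∷ q) with ⊑-compare p q
... | inj₁ r = inj₁ (refl ∷ r)
... | inj₂ r = inj₂ (refl ∷ r)

take-⊑ : ∀ n v → take n v ⊑ v
take-⊑ zero    v       = []
take-⊑ (suc n) []      = []
take-⊑ (suc n) (b ∷ v) = refl ∷ take-⊑ n v

length-child : ∀ u b → length (child u b) ≡ suc (length u)
length-child u b = trans (length-++ u) (+-comm (length u) 1)

prefix-of-length : ∀ {n v} → n ≤ length v → Σ Node λ u → u ⊑ v × length u ≡ n
prefix-of-length {n} {v} n≤v = take n v , take-⊑ n v , trans (length-take n v) (m≤n⇒m⊓n≡m n≤v)

⊑-next : ∀ {u v} → u ⊑ v → u ≡ v ⊎ Σ Bool λ b → child u b ⊑ v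
⊑-next {v = []}    []         = inj₁ refl
⊑-next {v = b ∷ v} []         = inj₂ (b , refl ∷ [])
⊑-next             (refl ∷ p) with ⊑-next p
... | inj₁ e       = inj₁ (cong (_ ∷_) e)
... | inj₂ (b , q) = inj₂ (b , refl ∷ q)

interval : ∀ {u v n} → u ⊑ v → length u ≤ n → n ≤ length v →
           Σ Node λ w → u ⊑ w × w ⊑ v × length w ≡ n
interval u⊑v u≤n n≤v with prefix-of-length n≤v
... | w , w⊑v , refl with ⊑-compare u⊑v w⊑v
...   | inj₁ u⊑w = w , u⊑w , w⊑v , refl
...   | inj₂ w⊑u with refl ← ⊑-length⁻ w⊑u u≤n = w , ⊑-refl , w⊑v , refl

_≺_ : Node → Node → Set
_≺_ = Lex-< _≡_ Bool._<_

≺-compare : ∀ u v → u ≺ v ⊎ u ≡ v ⊎ v ≺ u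
≺-compare u v with <-compare sym Bool.<-cmp u v
... | tri< u≺v _ _ = inj₁ u≺v
... | tri≈ _ u≡v _ = inj₂ (inj₁ (Pointwise-≡⇒≡ u≡v))
... | tri> _ _ v≺u = inj₂ (inj₂ v≺u)

≺-irrefl : ∀ {u} → ¬ u ≺ u
≺-irrefl (next _ u≺u) = ≺-irrefl u≺u

Branch : Node → Node → Set
Branch u v = Σ Node λ w → child w false ⊑ u × child w true ⊑ v

-- Splits the order into a prefix case and a branching case. Both can be expressed by successors and
-- `⊑`, which is what makes `≺` definable.
≺⇒⊑⊎Branch : ∀ {u v} → u ≺ v → (u ⊑ v × u ≢ v) ⊎ Branch u v
≺⇒⊑⊎Branch halt          = inj₁ ([] , λ ())
≺⇒⊑⊎Branch (this f<t)    = inj₂ ([] , refl ∷ [] , refl ∷ [])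
≺⇒⊑⊎Branch (next refl p) with ≺⇒⊑⊎Branch p
... | inj₁ (q , u≢v)    = inj₁ (refl ∷ q , λ { refl → u≢v refl })
... | inj₂ (w , q , r)  = inj₂ (_ ∷ w , refl ∷ q , refl ∷ r)

⊑⊎Branch⇒≺ : ∀ {u v} → (u ⊑ v × u ≢ v) ⊎ Branch u v → u ≺ v
⊑⊎Branch⇒≺ {v = []}     (inj₁ ([] , u≢v))                        = ⊥-elim (u≢v refl)
⊑⊎Branch⇒≺ {v = _ ∷ _}  (inj₁ ([] , _))                          = halt
⊑⊎Branch⇒≺              (inj₁ (refl ∷ p , u≢v))                  =
  next refl (⊑⊎Branch⇒≺ (inj₁ (p , u≢v ∘ cong (_ ∷_))))
⊑⊎Branch⇒≺              (inj₂ ([] , refl ∷ _ , refl ∷ _))        = this f<t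
⊑⊎Branch⇒≺              (inj₂ (_ ∷ w , refl ∷ p , refl ∷ q))     =
  next refl (⊑⊎Branch⇒≺ (inj₂ (w , p , q)))

-- The words of length at most `n` in depth-first order, so that the list comes out sorted by `≺`.
words : ℕ → List Node
words zero    = [] ∷ []
words (suc n) = [] ∷ (map (false ∷_) (words n) ++ map (true ∷_) (words n))

∈-words : ∀ n u → length u ≤ n → u ∈ words n
∈-words zero    []          _         = here refl
∈-words (suc n) []          _         = here refl
∈-words (suc n) (false ∷ u) (s≤s u≤n) = there (∈-++⁺ˡ (∈-map⁺ _ (∈-words n u u≤n)))
∈-words (suc n) (true ∷ u)  (s≤s u≤n) =
  there (∈-++⁺ʳ (map (false ∷_) (words n)) (∈-map⁺ _ (∈-words n u u≤n)))

words-sorted : ∀ n → AllPairs (λ u v → ¬ v ≺ u) (words n)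
words-sorted zero    = [] ∷ []
words-sorted (suc n) =
  All.tabulate (λ _ → xs≮[]) ∷
  AllPairs.++⁺ (half false) (half true)
    (All.tabulate λ u∈ → All.tabulate λ v∈ → apart (∈-map⁻ _ u∈) (∈-map⁻ _ v∈))
  where
  strip : ∀ {b u v} → (b ∷ u) ≺ (b ∷ v) → u ≺ v
  strip (this b<b)    = ⊥-elim (Bool.<-irrefl refl b<b)
  strip (next _ u≺v)  = u≺v
  half : ∀ b → AllPairs (λ u v → ¬ v ≺ u) (map (b ∷_) (words n))
  half b = AllPairs.map⁺ (sorted (words-sorted n))
    where
    sorted : ∀ {l} → AllPairs (λ u v → ¬ v ≺ u) l → AllPairs (λ u v → ¬ (b ∷ v) ≺ (b ∷ u)) l
    sorted []       = []
    sorted (p ∷ ps) = All.map (_∘ strip) p ∷ sorted ps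
  apart : ∀ {u v} → (∃ λ u′ → u′ ∈ words n × u ≡ false ∷ u′) →
          (∃ λ v′ → v′ ∈ words n × v ≡ true ∷ v′) → ¬ v ≺ u
  apart (_ , _ , refl) (_ , _ , refl) (this ())
  apart (_ , _ , refl) (_ , _ , refl) (next () _)

Fits : List Node → ℕ → Set
Fits X n = ∀ v → v ∈ X → length v ≤ n

fits : ∀ X → Σ ℕ (Fits X)
fits []      = 0 , λ _ ()
fits (u ∷ X) with fits X
... | n , X≤n = length u ⊔ n , λ where
  v (here refl) → m≤m⊔n _ n
  v (there v∈X) → ≤-trans (X≤n v v∈X) (m≤n⊔m (length u) n)

module _ {k : ℕ} (t : Tree k) where

  InDom-⊑ : ∀ {u v} → u ⊑ v → InDom t v → InDom t u
  InDom-⊑ {u} {v} p dv = go (reverseView v) p dv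
    where
    go : ∀ {v} → Reverse v → u ⊑ v → InDom t v → InDom t u
    go []             []  dv = dv
    go (w ∶ rs ∶ʳ b) p dv with ⊑-child⁻ w p
    ... | inj₁ q    = go rs q (prefix-closed t w b dv)
    ... | inj₂ refl = dv

-- Classical finite sets of nodes

module Classical (em : ExcludedMiddle 0ℓ) where

  stable : ∀ {P : Set} → ¬ ¬ P → P
  stable = decidable-stable em

  ¬∀⇒∃¬ : ∀ {A : Set} {P : A → Set} → ¬ (∀ x → P x) → Σ A λ x → ¬ P x
  ¬∀⇒∃¬ ¬∀ = stable λ ¬∃ → ¬∀ λ x → stable λ ¬Px → ¬∃ (x , ¬Px)

  -- There are finitely many words of bounded length, and excluded middle filters them by any
  -- property.
  comprehension : (P : Node → Set) (n : ℕ) → (∀ v → P v → length v ≤ n) →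
                  Σ (List Node) λ X → ∀ v → v ∈ X ⇔ P v
  comprehension P n P≤n = filter (λ v → em {P v}) (words n) , λ v → mk⇔
    (λ v∈ → proj₂ (∈-filter⁻ (λ v → em {P v}) {xs = words n} v∈))
    (λ Pv → ∈-filter⁺ (λ v → em {P v}) (∈-words n v (P≤n v Pv)) Pv)

  -- Greedy search: drop the first node if some member of the family avoids it.
  lex-minimum : (F : List Node → Set) (l : List Node) → AllPairs (λ u v → ¬ v ≺ u) l →
    ∀ X → F X → Σ (List Node) λ U → F U × ∀ V → F V →
      (∀ v → v ∈ l → v ∈ U ⇔ v ∈ V) ⊎
      (Σ Node λ y → y ∈ V × ¬ y ∈ U × ∀ z → z ∈ l → z ≺ y → z ∈ U ⇔ z ∈ V)
  lex-minimum F [] [] X FX = X , FX , λ V FV → inj₁ λ _ ()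
  lex-minimum F (y ∷ l) (y≤ ∷ sorted) X FX with em {Σ (List Node) λ V → F V × ¬ y ∈ V}
  ... | yes (V₀ , FV₀ , y∉V₀)
      with lex-minimum (λ V → F V × ¬ y ∈ V) l sorted V₀ (FV₀ , y∉V₀)
  ...   | U , (FU , y∉U) , least = U , FU , compare
    where
    compare : ∀ V → F V → _
    compare V FV with em {y ∈ V}
    -- Sortedness leaves no node of `l` before `y`, so `y` is the first difference.
    ... | yes y∈V = inj₂ (y , y∈V , y∉U , λ where
            z (here refl)  z≺y → ⊥-elim (≺-irrefl z≺y)
            z (there z∈l)  z≺y → ⊥-elim (All.lookup y≤ z∈l z≺y))
    ... | no y∉V with least V (FV , y∉V)
    ...   | inj₁ same = inj₁ λ where
            v (here refl) → mk⇔ (⊥-elim ∘ y∉U) (⊥-elim ∘ y∉V)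
            v (there v∈l) → same v v∈l
    ...   | inj₂ (x , x∈V , x∉U , same) = inj₂ (x , x∈V , x∉U , λ where
            z (here refl)  _   → mk⇔ (⊥-elim ∘ y∉U) (⊥-elim ∘ y∉V)
            z (there z∈l) z≺x → same z z∈l z≺x)
  lex-minimum F (y ∷ l) (y≤ ∷ sorted) X FX | no none with lex-minimum F l sorted X FX
  ... | U , FU , least = U , FU , compare
    where
    always : ∀ V → F V → y ∈ V
    always V FV = stable λ y∉V → none (V , FV , y∉V)
    both : ∀ V → F V → y ∈ U ⇔ y ∈ V
    both V FV = mk⇔ (λ _ → always V FV) (λ _ → always U FU)
    compare : ∀ V → F V → _
    compare V FV with least V FV
    ... | inj₁ same = inj₁ λ where
            v (here refl) → both V FV
            v (there v∈l) → same v v∈l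
    ... | inj₂ (x , x∈V , x∉U , same) = inj₂ (x , x∈V , x∉U , λ where
            z (here refl)  _   → both V FV
            z (there z∈l) z≺x → same z z∈l z≺x)

-- WMSO formulas

ren : ∀ {k m n m′ n′} → (Fin m → Fin m′) → (Fin n → Fin n′) → Form k m n → Form k m′ n′
ren e f (lab a x)    = lab a (e x)
ren e f (succ b x y) = succ b (e x) (e y)
ren e f (eqv x y)    = eqv (e x) (e y)
ren e f (mem x X)    = mem (e x) (f X)
ren e f (neg φ)      = neg (ren e f φ)
ren e f (and φ ψ)    = and (ren e f φ) (ren e f ψ)
ren e f (ex1 φ)      = ex1 (ren (lift 1 e) f φ)
ren e f (ex2 φ)      = ex2 (ren e (lift 1 f) φ)

_≗ₛ_ : ∀ {n} → (Fin n → List Node) → (Fin n → List Node) → Set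
σ ≗ₛ σ′ = ∀ X v → v ∈ σ X ⇔ v ∈ σ′ X

module _ {k : ℕ} {t : Tree k} where

  Sat-ren : ∀ {m n m′ n′} (φ : Form k m n) {e : Fin m → Fin m′} {f : Fin n → Fin n′} {ρ ρ′ σ σ′} →
            (∀ x → ρ (e x) ≡ ρ′ x) → (σ ∘ f) ≗ₛ σ′ → Sat (ren e f φ) t ρ σ ⇔ Sat φ t ρ′ σ′
  Sat-ren (lab a x)    p q rewrite p x       = ⇔-id _
  Sat-ren (succ b x y) p q rewrite p x | p y = ⇔-id _
  Sat-ren (eqv x y)    p q rewrite p x | p y = ⇔-id _
  Sat-ren (mem x X)    p q rewrite p x       = q X _
  Sat-ren (neg φ)      p q = mk⇔ (_∘ from (Sat-ren φ p q)) (_∘ to (Sat-ren φ p q))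
  Sat-ren (and φ ψ)    p q = mk⇔
    (λ (a , b) → to (Sat-ren φ p q) a , to (Sat-ren ψ p q) b)
    (λ (a , b) → from (Sat-ren φ p q) a , from (Sat-ren ψ p q) b)
  Sat-ren (ex1 φ) {e} {f} {ρ} {ρ′} {σ} {σ′} p q = mk⇔
    (λ (v , d , s) → v , d , to (body v) s) (λ (v , d , s) → v , d , from (body v) s)
    where
    body : ∀ v → Sat (ren (lift 1 e) f φ) t (v VF.∷ ρ) σ ⇔ Sat φ t (v VF.∷ ρ′) σ′
    body v = Sat-ren φ (λ { zero → refl ; (suc x) → p x }) q
  Sat-ren (ex2 φ) {e} {f} {ρ} {ρ′} {σ} {σ′} p q = mk⇔
    (λ (X , d , s) → X , d , to (body X) s) (λ (X , d , s) → X , d , from (body X) s)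
    where
    body : ∀ X → Sat (ren e (lift 1 f) φ) t ρ (X VF.∷ σ) ⇔ Sat φ t ρ′ (X VF.∷ σ′)
    body X = Sat-ren φ p (λ { zero v → ⇔-id _ ; (suc Y) v → q Y v })

  -- Satisfaction sees a list only through its members. Passing through `ren id id φ` reduces this
  -- to `Sat-ren`, without a second induction on formulas.
  Sat-cong : ∀ {m n} (φ : Form k m n) {ρ ρ′ σ σ′} →
             (∀ x → ρ x ≡ ρ′ x) → σ ≗ₛ σ′ → Sat φ t ρ σ ⇔ Sat φ t ρ′ σ′
  Sat-cong φ p q =
    Sat-ren φ {id} {id} p q ⇔-∘ ⇔-sym (Sat-ren φ {id} {id} (λ _ → refl) (λ _ _ → ⇔-id _))

-- Definable predicates

record Env {k m n} (t : Tree k) (ρ : Fin m → Node) (σ : Fin n → List Node) : Set where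
  constructor env
  field
    nodes : ∀ x → InDom t (ρ x)
    sets  : ∀ X → All (InDom t) (σ X)

env₁ : ∀ {k m n} {t : Tree k} {ρ : Fin m → Node} {σ : Fin n → List Node} {v} →
       InDom t v → Env t ρ σ → Env t (v VF.∷ ρ) σ
env₁ d (env dρ dσ) = env (λ { zero → d ; (suc x) → dρ x }) dσ

env₂ : ∀ {k m n} {t : Tree k} {ρ : Fin m → Node} {σ : Fin n → List Node} {X} →
       All (InDom t) X → Env t ρ σ → Env t ρ (X VF.∷ σ)
env₂ d (env dρ dσ) = env dρ (λ { zero → d ; (suc x) → dσ x })

Predicate : ℕ → ℕ → ℕ → Set₁
Predicate k m n = Tree k → (Fin m → Node) → (Fin n → List Node) → Set

-- Pairs a semantic predicate with a formula for it, so that formulas are assembled by combinators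
-- and reasoned about semantically. Correctness is asked only of valuations in the tree, the range
-- of the quantifiers.
record Def {k m n} (P : Predicate k m n) : Set where
  constructor def
  field
    form : Form k m n
    spec : ∀ {t ρ σ} → Env t ρ σ → Sat form t ρ σ ⇔ P t ρ σ

two : ∀ {A : Set} → A → A → Fin 2 → A
two x y zero    = x
two x y (suc _) = y

none : ∀ {A : Set} → Fin 0 → A
none ()

module Definability (em : ExcludedMiddle 0ℓ) {k : ℕ} where
  open Classical em

  module _ {m n : ℕ} where

    d-map : ∀ {P Q : Predicate k m n} → (∀ {t ρ σ} → Env t ρ σ → P t ρ σ ⇔ Q t ρ σ) → Def P → Def Q
    d-map h (def φ s) = def φ λ d → h d ⇔-∘ s d

    d-sat : (φ : Form k m n) → Def (Sat φ)
    d-sat φ = def φ λ _ → ⇔-id _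

    d-not : ∀ {P : Predicate k m n} → Def P → Def (λ t ρ σ → ¬ P t ρ σ)
    d-not (def φ s) = def (neg φ) λ d → mk⇔ (_∘ from (s d)) (_∘ to (s d))

    d-and : ∀ {P Q : Predicate k m n} → Def P → Def Q → Def (λ t ρ σ → P t ρ σ × Q t ρ σ)
    d-and (def φ s) (def ψ r) = def (and φ ψ) λ d → mk⇔
      (λ (a , b) → to (s d) a , to (r d) b) (λ (a , b) → from (s d) a , from (r d) b)

    -- The syntax has negation, conjunction and existential quantifiers; excluded middle justifies
    -- the usual encodings of the rest.
    d-imp : ∀ {P Q : Predicate k m n} → Def P → Def Q → Def (λ t ρ σ → P t ρ σ → Q t ρ σ)
    d-imp p q = d-map
      (λ _ → mk⇔ (λ h a → stable λ ¬b → h (a , ¬b)) (λ h (a , ¬b) → ¬b (h a)))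
      (d-not (d-and p (d-not q)))

    d-or : ∀ {P Q : Predicate k m n} → Def P → Def Q → Def (λ t ρ σ → P t ρ σ ⊎ Q t ρ σ)
    d-or p q = d-map
      (λ _ → mk⇔ (λ h → stable λ ¬c → h ((¬c ∘ inj₁) , (¬c ∘ inj₂)))
                 (λ { (inj₁ a) (¬a , _) → ¬a a ; (inj₂ b) (_ , ¬b) → ¬b b }))
      (d-not (d-and (d-not p) (d-not q)))

    d-iff : ∀ {P Q : Predicate k m n} → Def P → Def Q → Def (λ t ρ σ → P t ρ σ ⇔ Q t ρ σ)
    d-iff p q = d-map (λ _ → mk⇔ (λ (f , g) → mk⇔ f g) (λ e → to e , from e))
      (d-and (d-imp p q) (d-imp q p))

  module _ {m n : ℕ} {P : Predicate k (suc m) n} where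

    d-ex1 : Def P → Def (λ t ρ σ → Σ Node λ v → InDom t v × P t (v VF.∷ ρ) σ)
    d-ex1 (def φ s) = def (ex1 φ) λ d → mk⇔
      (λ (v , dv , a) → v , dv , to (s (env₁ dv d)) a)
      (λ (v , dv , a) → v , dv , from (s (env₁ dv d)) a)

    d-all1 : Def P → Def (λ t ρ σ → ∀ v → InDom t v → P t (v VF.∷ ρ) σ)
    d-all1 (def φ s) = def (neg (ex1 (neg φ))) λ d → mk⇔
      (λ h v dv → stable λ ¬p → h (v , dv , ¬p ∘ to (s (env₁ dv d))))
      (λ h (v , dv , ¬p) → ¬p (from (s (env₁ dv d)) (h v dv)))

  module _ {m n : ℕ} {P : Predicate k m (suc n)} where

    d-ex2 : Def P → Def (λ t ρ σ → Σ (List Node) λ X → All (InDom t) X × P t ρ (X VF.∷ σ))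
    d-ex2 (def φ s) = def (ex2 φ) λ d → mk⇔
      (λ (X , dX , a) → X , dX , to (s (env₂ dX d)) a)
      (λ (X , dX , a) → X , dX , from (s (env₂ dX d)) a)

    d-all2 : Def P → Def (λ t ρ σ → ∀ X → All (InDom t) X → P t ρ (X VF.∷ σ))
    d-all2 (def φ s) = def (neg (ex2 (neg φ))) λ d → mk⇔
      (λ h X dX → stable λ ¬p → h (X , dX , ¬p ∘ to (s (env₂ dX d))))
      (λ h (X , dX , ¬p) → ¬p (from (s (env₂ dX d)) (h X dX)))

  d-ren : ∀ {m n m′ n′} {P : Predicate k m n} (e : Fin m → Fin m′) (f : Fin n → Fin n′) →
          Def P → Def (λ t ρ σ → P t (ρ ∘ e) (σ ∘ f))
  d-ren e f (def φ s) = def (ren e f φ) λ (env dρ dσ) →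
    s (env (dρ ∘ e) (dσ ∘ f)) ⇔-∘ Sat-ren φ (λ _ → refl) (λ _ _ → ⇔-id _)

  d-all : ∀ {c m n} {P : Fin c → Predicate k m n} → (∀ j → Def (P j)) →
          Def (λ t ρ σ → ∀ j → P j t ρ σ)
  -- The empty conjunction is the sentence that every node equals itself; it holds in the empty tree
  -- too.
  d-all {zero} h = d-map (λ _ → mk⇔ (λ _ ()) (λ _ (_ , _ , e) → e refl))
    (d-sat (neg (ex1 (neg (eqv zero zero)))))
  d-all {suc c} h = d-map
    (λ _ → mk⇔ (λ { (a , b) zero → a ; (a , b) (suc j) → b j }) (λ h → h zero , h ∘ suc))
    (d-and (h zero) (d-all (h ∘ suc)))

  -- Reachability by set quantification: `u ⊑ v` iff every finite set that contains `v` and is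
  -- closed under parents contains `u`. Closing towards the root keeps the least such set, the
  -- prefixes of `v`, finite.
  d-⊑ : Def {k} {2} {0} (λ t ρ σ → ρ zero ⊑ ρ (suc zero))
  d-⊑ = d-map (λ {t} {ρ} d → mk⇔ (sound t ρ d) (complete t ρ))
    (d-all2 (d-imp (d-sat (mem (suc zero) zero))
      (d-imp
        (d-all1 (d-all1 (d-imp (d-or (d-sat (succ false zero (suc zero)))
                                     (d-sat (succ true  zero (suc zero))))
                               (d-imp (d-sat (mem (suc zero) zero)) (d-sat (mem zero zero))))))
        (d-sat (mem zero zero)))))
    where
    Closed : Tree k → List Node → Set
    Closed t X = ∀ v → InDom t v → ∀ u → InDom t u →
      v ≡ child u false ⊎ v ≡ child u true → v ∈ X → u ∈ X
    InEveryClosed : Tree k → (Fin 2 → Node) → Set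
    InEveryClosed t ρ = ∀ X → All (InDom t) X → ρ (suc zero) ∈ X → Closed t X → ρ zero ∈ X
    sound : ∀ t ρ {σ : Fin 0 → List Node} → Env t ρ σ → InEveryClosed t ρ → ρ zero ⊑ ρ (suc zero)
    sound t ρ d h with comprehension (_⊑ ρ (suc zero)) _ (λ _ → Prefix.length-mono)
    ... | X , X⇔ = to (X⇔ _) (h X (All.tabulate λ v∈ → InDom-⊑ t (to (X⇔ _) v∈) (Env.nodes d (suc zero)))
        (from (X⇔ _) ⊑-refl)
        (λ { v _ u _ (inj₁ refl) v∈ → from (X⇔ u) (⊑-trans (⊑-child u _) (to (X⇔ v) v∈))
           ; v _ u _ (inj₂ refl) v∈ → from (X⇔ u) (⊑-trans (⊑-child u _) (to (X⇔ v) v∈)) }))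
    complete : ∀ t ρ → ρ zero ⊑ ρ (suc zero) → InEveryClosed t ρ
    complete t ρ p X dX v∈ closed = go (reverseView _) p v∈
      where
      go : ∀ {u v} → Reverse v → u ⊑ v → v ∈ X → u ∈ X
      go []            [] v∈ = v∈
      go (w ∶ rs ∶ʳ b) p  v∈ with ⊑-child⁻ w p
      ... | inj₂ refl = v∈
      ... | inj₁ q    = go rs q (closed _ dv w (InDom-⊑ t (⊑-child w b) dv) (side b) v∈)
        where
        dv = All.lookup dX v∈
        side : ∀ b → child w b ≡ child w false ⊎ child w b ≡ child w true
        side false = inj₁ refl
        side true  = inj₂ refl

  pre : ∀ {m n} → Fin m → Fin m → Form k m n
  pre x y = Def.form (d-ren (two x y) none d-⊑)

  Sat-pre : ∀ {m n t ρ σ} {x y : Fin m} → InDom t (ρ x) → InDom t (ρ y) →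
            Sat (pre {n = n} x y) t ρ σ ⇔ ρ x ⊑ ρ y
  Sat-pre {t = t} {ρ} {σ} {x} {y} dx dy =
    Def.spec d-⊑ {t} {ρ = ρ ∘ two x y} {σ = none} (env (λ { zero → dx ; (suc zero) → dy }) λ ()) ⇔-∘
    Sat-ren {t = t} (Def.form d-⊑) {e = two x y} {f = none} {ρ = ρ} {σ = σ} {σ′ = none} (λ _ → refl) (λ ())

-- Composition

-- The complete types over `l`: conjunctions that take each formula or its negation. Every valuation
-- satisfies one of them, and two valuations that share one agree on all of `l`. The base case is a
-- tautology.
signs : ∀ {k m n} → List (Form k m n) → List (Form k m n)
signs []      = neg (ex1 (neg (eqv zero zero))) ∷ []
signs (φ ∷ l) = map (and φ) (signs l) ++ map (and (neg φ)) (signs l)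

module Composition (em : ExcludedMiddle 0ℓ) {k : ℕ} where
  open Classical em
  open Definability em {k}

  -- The truth value of φ depends on the sets below the node i only through these formulas.
  tests : ∀ {m n} → Fin m → Form k m n → List (Form k m n)
  tests i (lab a x)    = and (pre i x) (lab a x) ∷ []
  -- An edge can enter the subtree only at its root, hence the second test.
  tests i (succ b x y) = and (pre i x) (and (pre i y) (succ b x y)) ∷ eqv i y ∷ []
  tests i (eqv x y)    = and (pre i x) (eqv x y) ∷ []
  tests i (mem x X)    = and (pre i x) (mem x X) ∷ []
  tests i (neg φ)      = tests i φ
  tests i (and φ ψ)    = tests i φ ++ tests i ψ
  -- The type asked of a witness also records whether it lies below `i`.
  tests i (ex1 φ)      = map ex1 (signs (pre (suc i) zero ∷ tests (suc i) φ))
  tests i (ex2 φ)      = map ex2 (signs (tests i φ))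

  module _ (t : Tree k) where

    Agree : ∀ {m n} → List (Form k m n) → (ρ ρ′ : Fin m → Node) (σ σ′ : Fin n → List Node) → Set
    Agree l ρ ρ′ σ σ′ = ∀ φ → φ ∈ l → Sat φ t ρ σ ⇔ Sat φ t ρ′ σ′

    Agree-sym : ∀ {m n} {l : List (Form k m n)} {ρ ρ′ σ σ′} → Agree l ρ ρ′ σ σ′ → Agree l ρ′ ρ σ′ σ
    Agree-sym A φ φ∈ = ⇔-sym (A φ φ∈)

    Agree-trans : ∀ {m n} {l : List (Form k m n)} {ρ ρ′ ρ″ σ σ′ σ″} →
                  Agree l ρ ρ′ σ σ′ → Agree l ρ′ ρ″ σ′ σ″ → Agree l ρ ρ″ σ σ″
    Agree-trans A B φ φ∈ = B φ φ∈ ⇔-∘ A φ φ∈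

    signs-sat : ∀ {m n} (l : List (Form k m n)) ρ σ → Σ (Form k m n) λ χ → χ ∈ signs l × Sat χ t ρ σ
    signs-sat []      ρ σ = _ , here refl , λ (_ , _ , e) → e refl
    signs-sat (φ ∷ l) ρ σ with signs-sat l ρ σ | em {Sat φ t ρ σ}
    ... | χ , χ∈ , s | yes p = and φ χ , ∈-++⁺ˡ (∈-map⁺ _ χ∈) , p , s
    ... | χ , χ∈ , s | no ¬p =
      and (neg φ) χ , ∈-++⁺ʳ (map (and φ) (signs l)) (∈-map⁺ _ χ∈) , ¬p , s

    signs-agree : ∀ {m n} (l : List (Form k m n)) {χ ρ ρ′ σ σ′} → χ ∈ signs l →
                  Sat χ t ρ σ → Sat χ t ρ′ σ′ → Agree l ρ ρ′ σ σ′
    signs-agree (φ ∷ l) {χ} χ∈ s s′ ψ ψ∈ with ∈-++⁻ (map (and φ) (signs l)) χ∈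
    signs-agree (φ ∷ l) χ∈ s s′ ψ ψ∈ | inj₁ q with ∈-map⁻ _ q | ψ∈
    ... | χ , χ∈l , refl | here refl = mk⇔ (λ _ → proj₁ s′) (λ _ → proj₁ s)
    ... | χ , χ∈l , refl | there ψ∈l = signs-agree l χ∈l (proj₂ s) (proj₂ s′) ψ ψ∈l
    signs-agree (φ ∷ l) χ∈ s s′ ψ ψ∈ | inj₂ q with ∈-map⁻ _ q | ψ∈
    ... | χ , χ∈l , refl | here refl = mk⇔ (⊥-elim ∘ proj₁ s) (⊥-elim ∘ proj₁ s′)
    ... | χ , χ∈l , refl | there ψ∈l = signs-agree l χ∈l (proj₂ s) (proj₂ s′) ψ ψ∈l

    module Below (u : Node) where

      -- `Inside` and `Outside` are complementary halves of equality of valuations. Each fixes one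
      -- side of the boundary of the subtree of `u`; on the other side a node variable may move but
      -- not cross.
      record Inside {m n} (i : Fin m) (ρ ρ′ : Fin m → Node) (σ σ′ : Fin n → List Node) : Set where
        constructor inside
        field
          root  : ρ i ≡ u
          root′ : ρ′ i ≡ u
          dom   : ∀ x → InDom t (ρ x)
          dom′  : ∀ x → InDom t (ρ′ x)
          nodes : ∀ x → (u ⊑ ρ x × ρ x ≡ ρ′ x) ⊎ (¬ u ⊑ ρ x × ¬ u ⊑ ρ′ x)
          sets  : ∀ X v → u ⊑ v → v ∈ σ X ⇔ v ∈ σ′ X

      record Outside {m n} (i : Fin m) (ρ ρ′ : Fin m → Node) (σ σ′ : Fin n → List Node) : Set where
        constructor outside
        field
          root  : ρ i ≡ u
          root′ : ρ′ i ≡ u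
          dom   : ∀ x → InDom t (ρ x)
          dom′  : ∀ x → InDom t (ρ′ x)
          nodes : ∀ x → (u ⊑ ρ x × u ⊑ ρ′ x) ⊎ (¬ u ⊑ ρ x × ρ x ≡ ρ′ x)
          sets  : ∀ X v → ¬ u ⊑ v → v ∈ σ X ⇔ v ∈ σ′ X

      split : ∀ v → (u ⊑ v × v ≡ v) ⊎ (¬ u ⊑ v × ¬ u ⊑ v)
      split v with em {u ⊑ v}
      ... | yes p = inj₁ (p , refl)
      ... | no ¬p = inj₂ (¬p , ¬p)

      Inside-refl : ∀ {m n} {i : Fin m} {ρ : Fin m → Node} {σ : Fin n → List Node} →
                    ρ i ≡ u → (∀ x → InDom t (ρ x)) → Inside i ρ ρ σ σ
      Inside-refl r d = inside r r d d (λ x → split _) (λ _ _ _ → ⇔-id _)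

      module _ {m n : ℕ} {i : Fin m} {ρ ρ′ : Fin m → Node} {σ σ′ : Fin n → List Node} where

        Inside-sym : Inside i ρ ρ′ σ σ′ → Inside i ρ′ ρ σ′ σ
        Inside-sym (inside r r′ d d′ ns ss) = inside r′ r d′ d flip λ X v p → ⇔-sym (ss X v p)
          where
          flip : ∀ x → (u ⊑ ρ′ x × ρ′ x ≡ ρ x) ⊎ (¬ u ⊑ ρ′ x × ¬ u ⊑ ρ x)
          flip x with ns x
          ... | inj₁ (p , e) = inj₁ (subst (u ⊑_) e p , sym e)
          ... | inj₂ (p , q) = inj₂ (q , p)

        Inside-node : ∀ {v v′} → InDom t v → InDom t v′ →
                      (u ⊑ v × v ≡ v′) ⊎ (¬ u ⊑ v × ¬ u ⊑ v′) →
                      Inside i ρ ρ′ σ σ′ → Inside (suc i) (v VF.∷ ρ) (v′ VF.∷ ρ′) σ σ′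
        Inside-node dv dv′ c (inside r r′ d d′ ns ss) = inside r r′
          (λ { zero → dv ; (suc x) → d x }) (λ { zero → dv′ ; (suc x) → d′ x })
          (λ { zero → c ; (suc x) → ns x }) ss

        Inside-set : ∀ {X X′} → (∀ v → u ⊑ v → v ∈ X ⇔ v ∈ X′) →
                     Inside i ρ ρ′ σ σ′ → Inside i ρ ρ′ (X VF.∷ σ) (X′ VF.∷ σ′)
        Inside-set c (inside r r′ d d′ ns ss) = inside r r′ d d′ ns
          (λ { zero → c ; (suc X) → ss X })

        Outside-sym : Outside i ρ ρ′ σ σ′ → Outside i ρ′ ρ σ′ σ
        Outside-sym (outside r r′ d d′ ns ss) = outside r′ r d′ d flip λ X v p → ⇔-sym (ss X v p)
          where
          flip : ∀ x → (u ⊑ ρ′ x × u ⊑ ρ x) ⊎ (¬ u ⊑ ρ′ x × ρ′ x ≡ ρ x)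
          flip x with ns x
          ... | inj₁ (p , q) = inj₁ (q , p)
          ... | inj₂ (p , e) = inj₂ (p ∘ subst (u ⊑_) (sym e) , sym e)

        Outside-node : ∀ {v v′} → InDom t v → InDom t v′ →
                       (u ⊑ v × u ⊑ v′) ⊎ (¬ u ⊑ v × v ≡ v′) →
                       Outside i ρ ρ′ σ σ′ → Outside (suc i) (v VF.∷ ρ) (v′ VF.∷ ρ′) σ σ′
        Outside-node dv dv′ c (outside r r′ d d′ ns ss) = outside r r′
          (λ { zero → dv ; (suc x) → d x }) (λ { zero → dv′ ; (suc x) → d′ x })
          (λ { zero → c ; (suc x) → ns x }) ss

        Outside-set : ∀ {X X′} → (∀ v → ¬ u ⊑ v → v ∈ X ⇔ v ∈ X′) →
                      Outside i ρ ρ′ σ σ′ → Outside i ρ ρ′ (X VF.∷ σ) (X′ VF.∷ σ′)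
        Outside-set c (outside r r′ d d′ ns ss) = outside r r′ d d′ ns
          (λ { zero → c ; (suc X) → ss X })

      Sat-below : ∀ {m n} (i x : Fin m) {ρ : Fin m → Node} (σ : Fin n → List Node) →
                  ρ i ≡ u → (∀ x → InDom t (ρ x)) → Sat (pre i x) t ρ σ ⇔ u ⊑ ρ x
      Sat-below i x {ρ} σ refl d = Sat-pre {t = t} {ρ} {σ} {i} {x} (d i) (d x)

      -- An implication suffices, as `Inside` is symmetric.
      Local : ∀ {m n} → Fin m → Form k m n → Set
      Local i φ = ∀ ρ ρ′ σ σ′ → Inside i ρ ρ′ σ σ′ → Sat φ t ρ σ → Sat φ t ρ′ σ′

      module _ {m n : ℕ} {i : Fin m} {ρ ρ′ : Fin m → Node} {σ σ′ : Fin n → List Node}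
               (I : Inside i ρ ρ′ σ σ′) where
        open Inside I

        below-≡ : ∀ {x} → u ⊑ ρ x → ρ x ≡ ρ′ x
        below-≡ {x} p with nodes x
        ... | inj₁ (_ , e)  = e
        ... | inj₂ (¬p , _) = ⊥-elim (¬p p)

        guard : ∀ x → Sat (pre i x) t ρ σ → ρ x ≡ ρ′ x × Sat (pre i x) t ρ′ σ′
        guard x s with to (Sat-below i x σ root dom) s
        ... | p = below-≡ p ,
          from (Sat-below i x σ′ root′ dom′) (subst (u ⊑_) (below-≡ p) p)

      Local-neg : ∀ {m n} {i : Fin m} (φ : Form k m n) → Local i φ → Local i (neg φ)
      Local-neg φ h _ _ _ _ I ¬s s = ¬s (h _ _ _ _ (Inside-sym I) s)

      Local-pre : ∀ {m n} (i x : Fin m) → Local {n = n} i (pre i x)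
      Local-pre i x _ _ _ _ I s = proj₂ (guard I x s)

      Local-signs : ∀ {m n} {i : Fin m} (l : List (Form k m n)) → All (Local i) l → All (Local i) (signs l)
      Local-signs []      []      = (λ _ _ _ _ _ _ (_ , _ , e) → e refl) ∷ []
      Local-signs {i = i} (φ ∷ l) (h ∷ hs) = All.++⁺
        (All.map⁺ (All.map (λ g _ _ _ _ I (a , b) → h _ _ _ _ I a , g _ _ _ _ I b) (Local-signs l hs)))
        (All.map⁺ (All.map (λ g _ _ _ _ I (a , b) → Local-neg φ h _ _ _ _ I a , g _ _ _ _ I b) (Local-signs l hs)))

      -- The guards place the variables of an atom below `u`, where both valuations coincide; for
      -- the root test, equality with `i` does this. A quantifier keeps its witness unchanged, which
      -- is on the same side of the boundary for both valuations.
      Local-tests : ∀ {m n} (i : Fin m) (φ : Form k m n) → All (Local i) (tests i φ)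
      Local-tests i (lab a x) =
        (λ _ _ _ _ I (p , s) → proj₂ (guard I x p) , trans (cong (label t) (sym (proj₁ (guard I x p)))) s) ∷ []
      Local-tests i (succ b x y) =
        (λ _ _ _ _ I (p , q , s) → proj₂ (guard I x p) , proj₂ (guard I y q) ,
          subst₂ (λ v w → w ≡ child v b) (proj₁ (guard I x p)) (proj₁ (guard I y q)) s) ∷
        (λ ρ _ _ _ I s → trans (trans (Inside.root′ I) (trans (sym (Inside.root I)) s))
          (below-≡ I {y} (subst (_⊑ ρ y) (Inside.root I) (subst (ρ i ⊑_) s ⊑-refl)))) ∷ []
      Local-tests i (eqv x y) =
        (λ _ _ σ _ I (p , s) → proj₂ (guard I x p) ,
          trans (sym (proj₁ (guard I x p)))
            (trans s (below-≡ I {y} (subst (u ⊑_) s (to (Sat-below i x σ (Inside.root I) (Inside.dom I)) p))))) ∷ []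
      Local-tests i (mem x X) =
        (λ _ _ σ σ′ I (p , s) → proj₂ (guard I x p) ,
          subst (_∈ σ′ X) (proj₁ (guard I x p))
            (to (Inside.sets I X _ (to (Sat-below i x σ (Inside.root I) (Inside.dom I)) p)) s)) ∷ []
      Local-tests i (neg φ)   = Local-tests i φ
      Local-tests i (and φ ψ) = All.++⁺ (Local-tests i φ) (Local-tests i ψ)
      Local-tests i (ex1 φ)   = All.map⁺ (All.map
        (λ h _ _ _ _ I (v , d , s) → v , d , h _ _ _ _ (Inside-node d d (split v) I) s)
        (Local-signs (pre (suc i) zero ∷ tests (suc i) φ)
                     (Local-pre (suc i) zero ∷ Local-tests (suc i) φ)))
      Local-tests i (ex2 φ)   = All.map⁺ (All.map
        (λ h _ _ _ _ I (X , d , s) → X , d , h _ _ _ _ (Inside-set (λ _ _ → ⇔-id _) I) s)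
        (Local-signs (tests i φ) (Local-tests i φ)))

      Inside⇒Agree : ∀ {m n} {i : Fin m} (φ : Form k m n) {ρ ρ′ σ σ′} →
                     Inside i ρ ρ′ σ σ′ → Agree (tests i φ) ρ ρ′ σ σ′
      Inside⇒Agree {i = i} φ I ψ ψ∈ = mk⇔ (h _ _ _ _ I) (h _ _ _ _ (Inside-sym I))
        where
        h : Local i ψ
        h = All.lookup (Local-tests i φ) ψ∈

      -- Grafts the part of `X′` below `u` into `X`. It merges the set witnesses of the two sides in
      -- `composition` and later performs the exchanges of `hybrid`.
      replace-below : (X X′ : List Node) → Σ (List Node) λ Y →
        (∀ v → u ⊑ v → v ∈ X′ ⇔ v ∈ Y) × (∀ v → ¬ u ⊑ v → v ∈ X ⇔ v ∈ Y) ×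
        (All (InDom t) X → All (InDom t) X′ → All (InDom t) Y)
      replace-below X X′ with fits X | fits X′
      ... | n , X≤n | n′ , X′≤n′
          with comprehension (λ v → (u ⊑ v × v ∈ X′) ⊎ (¬ u ⊑ v × v ∈ X)) (n ⊔ n′)
                 (λ { v (inj₁ (_ , v∈)) → ≤-trans (X′≤n′ v v∈) (m≤n⊔m n n′)
                    ; v (inj₂ (_ , v∈)) → ≤-trans (X≤n v v∈) (m≤m⊔n n n′) })
      ...   | Y , Y⇔ = Y ,
        (λ v p → mk⇔ (λ v∈ → from (Y⇔ v) (inj₁ (p , v∈)))
                     (λ v∈ → [ proj₂ , (λ (¬p , _) → ⊥-elim (¬p p)) ]′ (to (Y⇔ v) v∈))) ,
        (λ v ¬p → mk⇔ (λ v∈ → from (Y⇔ v) (inj₂ (¬p , v∈)))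
                      (λ v∈ → [ (λ (p , _) → ⊥-elim (¬p p)) , proj₂ ]′ (to (Y⇔ v) v∈))) ,
        (λ dX dX′ → All.tabulate λ v∈ →
          [ All.lookup dX′ ∘ proj₂ , All.lookup dX ∘ proj₂ ]′ (to (Y⇔ _) v∈))

      -- The Feferman-Vaught argument for a tree cut into a subtree and its context. An atom with
      -- its variables below `u` is decided by a guarded test, the others by `Outside`. Both
      -- hypotheses are symmetric, which settles negation.
      composition : ∀ {m n} {i : Fin m} (φ : Form k m n) {ρ ρ′ σ σ′} → Outside i ρ ρ′ σ σ′ →
                    Agree (tests i φ) ρ ρ′ σ σ′ → Sat φ t ρ σ → Sat φ t ρ′ σ′
      composition {i = i} (lab a x) {σ = σ} O A s with Outside.nodes O x
      ... | inj₂ (_ , e) = trans (cong (label t) (sym e)) s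
      ... | inj₁ (p , _) = proj₂ (to (A _ (here refl))
              (from (Sat-below i x σ (Outside.root O) (Outside.dom O)) p , s))
      composition {i = i} (succ b x y) {ρ} {ρ′} {σ} O A s with Outside.nodes O x | Outside.nodes O y
      ... | inj₁ (p , _)  | inj₁ (q , _) = proj₂ (proj₂ (to (A _ (here refl))
              ( from (Sat-below i x σ (Outside.root O) (Outside.dom O)) p
              , from (Sat-below i y σ (Outside.root O) (Outside.dom O)) q , s)))
      ... | inj₁ (p , _)  | inj₂ (¬q , _) =
              ⊥-elim (¬q (subst (u ⊑_) (sym s) (⊑-trans p (⊑-child _ b))))
      ... | inj₂ (_ , e)  | inj₂ (_ , e′) = subst₂ (λ v w → w ≡ child v b) e e′ s
      -- The edge enters from outside, so `y` is the root `u`; the root test carries this over to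
      -- `ρ′`.
      ... | inj₂ (¬p , e) | inj₁ (q , _) with ⊑-child⁻ (ρ x) (subst (u ⊑_) s q)
      ...   | inj₁ p  = ⊥-elim (¬p p)
      ...   | inj₂ e′ = trans (trans (sym y′≡) (trans (Outside.root′ O) e′)) (cong (λ v → child v b) e)
        where
        y′≡ : ρ′ i ≡ ρ′ y
        y′≡ = to (A _ (there (here refl))) (trans (Outside.root O) (trans e′ (sym s)))
      composition {i = i} (eqv x y) {σ = σ} O A s with Outside.nodes O x | Outside.nodes O y
      ... | inj₁ (p , _)  | _             = proj₂ (to (A _ (here refl))
              (from (Sat-below i x σ (Outside.root O) (Outside.dom O)) p , s))
      ... | inj₂ (¬p , _) | inj₁ (q , _)  = ⊥-elim (¬p (subst (u ⊑_) (sym s) q))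
      ... | inj₂ (_ , e)  | inj₂ (_ , e′) = trans (sym e) (trans s e′)
      composition {i = i} (mem x X) {ρ} {ρ′} {σ} {σ′} O A s with Outside.nodes O x
      ... | inj₁ (p , _)  = proj₂ (to (A _ (here refl))
              (from (Sat-below i x σ (Outside.root O) (Outside.dom O)) p , s))
      ... | inj₂ (¬p , e) = subst (_∈ σ′ X) e (to (Outside.sets O X _ ¬p) s)
      composition (neg φ) O A ¬s s = ¬s (composition φ (Outside-sym O) (Agree-sym A) s)
      composition {i = i} (and φ ψ) O A (s , r) =
        composition φ O (λ χ χ∈ → A χ (∈-++⁺ˡ χ∈)) s ,
        composition ψ O (λ χ χ∈ → A χ (∈-++⁺ʳ (tests i φ) χ∈)) r
      composition {i = i} (ex1 φ) {ρ} {ρ′} {σ} {σ′} O A (v , dv , s)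
        with signs-sat (pre (suc i) zero ∷ tests (suc i) φ) (v VF.∷ ρ) σ
      -- `χ` is the type of the witness `v`. As `ex1 χ` is a test, the second valuation has a node
      -- `v′` of the same type.
      ... | χ , χ∈ , r with to (A (ex1 χ) (∈-map⁺ ex1 χ∈)) (v , dv , r)
      ...   | v′ , dv′ , r′ = conclude (em {u ⊑ v})
        where
        open Outside O
        A′ : Agree (pre (suc i) zero ∷ tests (suc i) φ) (v VF.∷ ρ) (v′ VF.∷ ρ′) σ σ′
        A′ = signs-agree (pre (suc i) zero ∷ tests (suc i) φ) χ∈ r r′
        below : u ⊑ v ⇔ u ⊑ v′
        below = Sat-below (suc i) zero {v′ VF.∷ ρ′} σ′ root′ (λ { zero → dv′ ; (suc x) → dom′ x })
          ⇔-∘ (A′ _ (here refl) ⇔-∘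
          ⇔-sym (Sat-below (suc i) zero {v VF.∷ ρ} σ root (λ { zero → dv ; (suc x) → dom x })))
        conclude : Dec (u ⊑ v) → Sat (ex1 φ) t ρ′ σ′
        conclude (yes p) = v′ , dv′ ,
          composition φ (Outside-node dv dv′ (inj₁ (p , to below p)) O) (λ ψ → A′ ψ ∘ there) s
        -- A witness outside the subtree is kept. `v′` only transports the tests, which cannot see
        -- where outside a node lies.
        conclude (no ¬p) = v , dv ,
          composition φ (Outside-node dv dv (inj₂ (¬p , refl)) O)
            (Agree-trans (λ ψ → A′ ψ ∘ there)
              (Inside⇒Agree φ (Inside-node dv′ dv (inj₂ (¬p ∘ from below , ¬p))
                (Inside-refl (Outside.root′ O) (Outside.dom′ O))))) s
      composition {i = i} (ex2 φ) {ρ} {ρ′} {σ} {σ′} O A (X , dX , s)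
        with signs-sat (tests i φ) ρ (X VF.∷ σ)
      ... | χ , χ∈ , r with to (A (ex2 χ) (∈-map⁺ ex2 χ∈)) (X , dX , r)
      -- A set witness may have elements on both sides: `X` is kept outside, and `X′`, which has the
      -- same type, is used below `u`.
      ...   | X′ , dX′ , r′ with replace-below X X′
      ...     | Y , in-Y , out-Y , dY = Y , dY dX dX′ ,
        composition φ (Outside-set out-Y O)
          (Agree-trans (signs-agree (tests i φ) χ∈ r r′)
            (Inside⇒Agree φ (Inside-set in-Y (Inside-refl (Outside.root′ O) (Outside.dom′ O))))) s

-- Codes of classes

at : ∀ {A : Set} → A → Fin 1 → A
at x _ = x

module Coding (em : ExcludedMiddle 0ℓ) {k : ℕ} (E : Tree k → List Node → List Node → Set)
              (dE : Def {k} {0} {2} (λ t ρ σ → E t (σ zero) (σ (suc zero)))) where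
  open Classical em
  open Definability em {k}
  open Composition em {k}

  -- The added node variable names the root of the subtree to be tested.
  E-form : Form k 1 2
  E-form = ren none id (Def.form dE)

  E-tests : List (Form k 1 2)
  E-tests = tests zero E-form

  module Codes (t : Tree k) where

    -- The second set is empty because the tests look only below `u`, where the set used for
    -- comparison in `swap` has no element.
    Holds : Form k 1 2 → List Node → Node → Set
    Holds ψ X u = Sat ψ t (at u) (two X [])

    Needed : List Node → Node → Set
    Needed X v = ∀ W → All (InDom t) W → E t X W → Σ Node λ w → InDom t w × w ∈ W × v ⊑ w

    -- With quantification over finite sets, a subtree is infinite when no set exhausts it.
    Infinite : Node → Set
    Infinite v = ∀ X → All (InDom t) X → Σ Node λ y → InDom t y × v ⊑ y × ¬ y ∈ X

    -- An infinite subtree has a node on each of its levels to carry a mark; finite subtrees are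
    -- copied into the code as they are.
    Frontier : List Node → Node → Set
    Frontier X u = Infinite u × ¬ Needed X u × (∀ v → InDom t v → v ⊑ u → v ≢ u → Needed X v)

    Level : ℕ → Node → Node → Set
    Level i u y = u ⊑ y × length y ≡ i + length u

    -- The truth value of the j-th formula of l is stored in level i + j below u; the level after
    -- the last formula is always occupied and so delimits the code.
    Mark : List (Form k 1 2) → ℕ → List Node → Node → Node → Set
    Mark []      i X u y = Level i u y
    Mark (ψ ∷ l) i X u y = (Level i u y × Holds ψ X u) ⊎ Mark l (suc i) X u y

    -- The depth of these nodes is bounded, by `Bounded-length`.
    Bounded : List Node → Node → Set
    Bounded X y = ¬ Σ Node λ u → InDom t u × Frontier X u × u ⊑ y

    Code : List Node → List Node → Set
    Code X U = ∀ y → InDom t y → y ∈ U ⇔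
      ((Bounded X y × y ∈ X) ⊎ Σ Node λ u → InDom t u × Frontier X u × Mark E-tests 0 X u y)

    CodeOfClass : List Node → List Node → Set
    CodeOfClass X U = Σ (List Node) λ X′ → All (InDom t) X′ × E t X X′ × Code X′ U

    Same : List Node → List Node → Set
    Same U V = ∀ y → InDom t y → y ∈ U ⇔ y ∈ V

    -- The lexicographic order of characteristic functions along `≺`, with absence before presence.
    Less : List Node → List Node → Set
    Less U V = Σ Node λ y → InDom t y × y ∈ V × ¬ y ∈ U × ∀ z → InDom t z → z ≺ y → z ∈ U ⇔ z ∈ V

    Canonical : List Node → List Node → Set
    Canonical X U = CodeOfClass X U ×
      ∀ V → All (InDom t) V → CodeOfClass X V → Same U V ⊎ Less U V

  open Codes

  -- Formulas for the coding

  private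
    mem-at : ∀ {m n} (x : Fin m) (X : Fin n) → Def {k} (λ t ρ σ → ρ x ∈ σ X)
    mem-at x X = d-sat (mem x X)

    ⊑-at : ∀ {m n} (x y : Fin m) → Def {k} {m} {n} (λ t ρ σ → ρ x ⊑ ρ y)
    ⊑-at x y = d-ren (two x y) none d-⊑

    E-at : ∀ {m n} (X Y : Fin n) → Def {k} {m} {n} (λ t ρ σ → E t (σ X) (σ Y))
    E-at X Y = d-ren none (two X Y) dE

  -- The empty set in `Holds` is not a variable, so the formula quantifies over a set without
  -- elements.
  d-Holds : ∀ ψ → Def {k} {1} {1} (λ t ρ σ → Holds t ψ (σ zero) (ρ zero))
  d-Holds ψ = d-map
    (λ {t} {ρ} {σ} _ → mk⇔
      (λ (W , dW , empty , s) → to (Sat-ren ψ (λ { zero → refl }) (λ { zero v → ⇔-id _ ; (suc _) v →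
         mk⇔ (λ v∈ → ⊥-elim (empty (v , All.lookup dW v∈ , v∈))) (λ ()) })) s)
      (λ s → [] , [] , (λ { (_ , _ , ()) }) ,
        from (Sat-ren ψ (λ { zero → refl }) (λ { zero v → ⇔-id _ ; (suc _) v → ⇔-id _ })) s))
    (d-ex2 (d-and (d-not (d-ex1 (mem-at zero zero)))
                  (d-sat (ren id (two (suc zero) zero) ψ))))

  d-Needed : Def {k} {1} {1} (λ t ρ σ → Needed t (σ zero) (ρ zero))
  d-Needed = d-all2 (d-imp (E-at (suc zero) zero)
    (d-ex1 (d-and (mem-at zero zero) (⊑-at (suc zero) zero))))

  d-Infinite : Def {k} {1} {0} (λ t ρ σ → Infinite t (ρ zero))
  d-Infinite = d-all2 (d-ex1 (d-and (⊑-at (suc zero) zero) (d-not (mem-at zero zero))))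

  d-Frontier : Def {k} {1} {1} (λ t ρ σ → Frontier t (σ zero) (ρ zero))
  d-Frontier = d-and (d-ren id none d-Infinite) (d-and (d-not d-Needed)
    (d-all1 (d-imp (⊑-at zero (suc zero)) (d-imp (d-not (d-sat (eqv zero (suc zero))))
      (d-ren (at zero) id d-Needed)))))

  -- The offset is a number outside the logic; the formula walks down `i` edges.
  d-Level : ∀ i → Def {k} {2} {0} (λ t ρ σ → Level t i (ρ zero) (ρ (suc zero)))
  d-Level zero = d-map
    (λ {t} {ρ} _ → mk⇔ (λ e → subst (ρ zero ⊑_) e ⊑-refl , cong length (sym e))
                       (λ (p , e) → ⊑-length⁻ p (≤-reflexive e)))
    (d-sat (eqv zero (suc zero)))
  d-Level (suc i) = d-map (λ {t} {ρ} d → mk⇔ (down t ρ) (up t ρ (Env.nodes d (suc zero))))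
    (d-ex1 (d-and (d-or (d-sat (succ false (suc zero) zero)) (d-sat (succ true (suc zero) zero)))
                  (d-ren (two zero (suc (suc zero))) id (d-Level i))))
    where
    Step : Tree k → (Fin 2 → Node) → Set
    Step t ρ = Σ Node λ z → InDom t z × (z ≡ child (ρ zero) false ⊎ z ≡ child (ρ zero) true) ×
      Level t i z (ρ (suc zero))
    shift : ∀ u b → i + length (child u b) ≡ suc (i + length u)
    shift u b = trans (cong (i +_) (length-child u b)) (+-suc i (length u))
    down : ∀ t ρ → Step t ρ → Level t (suc i) (ρ zero) (ρ (suc zero))
    down t ρ (_ , _ , inj₁ refl , p , e) = ⊑-trans (⊑-child _ false) p , trans e (shift (ρ zero) false)
    down t ρ (_ , _ , inj₂ refl , p , e) = ⊑-trans (⊑-child _ true) p , trans e (shift (ρ zero) true)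
    up : ∀ t ρ → InDom t (ρ (suc zero)) → Level t (suc i) (ρ zero) (ρ (suc zero)) → Step t ρ
    up t ρ dy (p , e) with ⊑-next p
    ... | inj₁ u≡y         = ⊥-elim (m≢1+n+m (length (ρ zero)) (trans (cong length u≡y) e))
    ... | inj₂ (false , q) = _ , InDom-⊑ t q dy , inj₁ refl , q , trans e (sym (shift (ρ zero) false))
    ... | inj₂ (true , q)  = _ , InDom-⊑ t q dy , inj₂ refl , q , trans e (sym (shift (ρ zero) true))

  d-Mark : ∀ l i → Def {k} {2} {1} (λ t ρ σ → Mark t l i (σ zero) (ρ zero) (ρ (suc zero)))
  d-Mark []      i = d-ren id none (d-Level i)
  d-Mark (ψ ∷ l) i = d-or (d-and (d-ren id none (d-Level i)) (d-ren (at zero) id (d-Holds ψ)))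
                          (d-Mark l (suc i))

  d-Bounded : Def {k} {1} {1} (λ t ρ σ → Bounded t (σ zero) (ρ zero))
  d-Bounded = d-not (d-ex1 (d-and (d-ren (at zero) id d-Frontier) (⊑-at zero (suc zero))))

  d-Code : Def {k} {0} {2} (λ t ρ σ → Code t (σ zero) (σ (suc zero)))
  d-Code = d-all1 (d-iff (mem-at zero (suc zero))
    (d-or (d-and (d-ren id (at zero) d-Bounded) (mem-at zero zero))
          (d-ex1 (d-and (d-ren (at zero) (at zero) d-Frontier)
                        (d-ren (two zero (suc zero)) (at zero) (d-Mark E-tests 0))))))

  d-CodeOfClass : Def {k} {0} {2} (λ t ρ σ → CodeOfClass t (σ zero) (σ (suc zero)))
  d-CodeOfClass = d-ex2 (d-and (E-at (suc zero) zero) (d-ren none (two zero (suc (suc zero))) d-Code))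

  d-Same : Def {k} {0} {2} (λ t ρ σ → Same t (σ zero) (σ (suc zero)))
  d-Same = d-all1 (d-iff (mem-at zero zero) (mem-at zero (suc zero)))

  d-≺ : Def {k} {2} {0} (λ t ρ σ → ρ zero ≺ ρ (suc zero))
  d-≺ = d-map (λ {t} {ρ} d → mk⇔ (sound t ρ) (complete t ρ d))
    (d-or (d-and (⊑-at zero (suc zero)) (d-not (d-sat (eqv zero (suc zero)))))
      (d-ex1 (d-and
        (d-ex1 (d-and (d-sat (succ false (suc zero) zero)) (⊑-at zero (suc (suc zero)))))
        (d-ex1 (d-and (d-sat (succ true (suc zero) zero)) (⊑-at zero (suc (suc (suc zero)))))))))
    where
    Lower : Tree k → Node → Bool → Node → Set
    Lower t w b u = Σ Node λ v → InDom t v × v ≡ child w b × v ⊑ u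
    Order : Tree k → (Fin 2 → Node) → Set
    Order t ρ = (ρ zero ⊑ ρ (suc zero) × ρ zero ≢ ρ (suc zero)) ⊎
      Σ Node λ w → InDom t w × Lower t w false (ρ zero) × Lower t w true (ρ (suc zero))
    sound : ∀ t ρ → Order t ρ → ρ zero ≺ ρ (suc zero)
    sound t ρ (inj₁ p) = ⊑⊎Branch⇒≺ (inj₁ p)
    sound t ρ (inj₂ (w , _ , (_ , _ , refl , p) , (_ , _ , refl , q))) = ⊑⊎Branch⇒≺ (inj₂ (w , p , q))
    complete : ∀ t ρ {σ : Fin 0 → List Node} → Env t ρ σ → ρ zero ≺ ρ (suc zero) → Order t ρ
    complete t ρ d p with ≺⇒⊑⊎Branch p
    ... | inj₁ q = inj₁ q
    ... | inj₂ (w , q , r) = inj₂ (w , InDom-⊑ t (⊑-child w false) d₀ ,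
            (_ , d₀ , refl , q) , (_ , InDom-⊑ t r (Env.nodes d (suc zero)) , refl , r))
      where d₀ = InDom-⊑ t q (Env.nodes d zero)

  d-Less : Def {k} {0} {2} (λ t ρ σ → Less t (σ zero) (σ (suc zero)))
  d-Less = d-ex1 (d-and (mem-at zero (suc zero)) (d-and (d-not (mem-at zero zero))
    (d-all1 (d-imp (d-ren id none d-≺) (d-iff (mem-at zero zero) (mem-at zero (suc zero)))))))

  d-Canonical : Def {k} {0} {2} (λ t ρ σ → Canonical t (σ zero) (σ (suc zero)))
  d-Canonical = d-and d-CodeOfClass (d-all2 (d-imp (d-ren none (two (suc zero) zero) d-CodeOfClass)
    (d-or (d-ren none (two (suc (suc zero)) zero) d-Same)
          (d-ren none (two (suc (suc zero)) zero) d-Less))))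

-- Classes and codes in a fixed tree

module Classes (em : ExcludedMiddle 0ℓ) {k : ℕ} (E : Tree k → List Node → List Node → Set)
               (dE : Def {k} {0} {2} (λ t ρ σ → E t (σ zero) (σ (suc zero))))
               (t : Tree k)
               (E-dom : ∀ {X Y} → E t X Y → All (InDom t) X × All (InDom t) Y)
               (E-sym : ∀ {X Y} → E t X Y → E t Y X)
               (E-trans : ∀ {X Y W} → E t X Y → E t Y W → E t X W) where
  open Classical em
  open Definability em {k}
  open Composition em {k}
  open Coding em E dE
  open Codes t

  private
    _~_ : List Node → List Node → Set
    _~_ = E t

  -- The relation is a partial equivalence on lists; `X ~ X` expresses that `X` has a class.
  ~-refl : ∀ {X Y} → X ~ Y → X ~ X
  ~-refl X~Y = E-trans X~Y (E-sym X~Y)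

  E-form⇔ : ∀ {u X Y} → All (InDom t) X → All (InDom t) Y → Sat E-form t (at u) (two X Y) ⇔ X ~ Y
  E-form⇔ {u} {X} {Y} dX dY =
    Def.spec dE {t} {none} (env (λ ()) (λ { zero → dX ; (suc _) → dY })) ⇔-∘
    Sat-ren {t = t} (Def.form dE) {e = none} {f = id} {ρ = at u} {σ = two X Y} (λ ()) (λ _ _ → ⇔-id _)

  -- `E` has a defining formula, which cannot distinguish lists with the same members.
  ~-ext : ∀ {X Y W} → X ~ Y → All (InDom t) W → (∀ v → v ∈ Y ⇔ v ∈ W) → X ~ W
  ~-ext X~Y dW Y≗W with E-dom X~Y
  ... | dX , dY = to (E-form⇔ {[]} dX dW) (to (Sat-cong E-form (λ _ → refl)
          (λ { zero v → ⇔-id _ ; (suc _) v → Y≗W v })) (from (E-form⇔ {[]} dX dY) X~Y))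

  swap : ∀ {X Y Y′ u} → X ~ Y → InDom t u → ¬ Needed X u → All (InDom t) Y′ →
         (∀ v → ¬ u ⊑ v → v ∈ Y ⇔ v ∈ Y′) →
         (∀ ψ → ψ ∈ E-tests → Holds ψ Y u ⇔ Holds ψ Y′ u) → X ~ Y′
  swap {X} {Y} {Y′} {u} X~Y du unneeded dY′ out holds with ¬∀⇒∃¬ unneeded
  ... | W , h = E-trans X~W (E-sym Y′~W)
    where
    dW : All (InDom t) W
    -- `W` refutes the implication in `Needed`; its hypotheses are recovered classically.
    dW = stable λ ¬d → h λ d → ⊥-elim (¬d d)
    X~W : X ~ W
    X~W = stable λ ¬e → h λ _ e → ⊥-elim (¬e e)
    avoids : ∀ w → w ∈ W → ¬ u ⊑ w
    avoids w w∈ p = h λ _ _ → w , All.lookup dW w∈ , w∈ , p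
    open Below t u
    rest : ∀ V → Agree t E-tests (at u) (at u) (two V W) (two V [])
    rest V = Inside⇒Agree E-form (inside refl refl (at du) (at du) (λ _ → inj₁ (⊑-refl , refl))
      (λ { zero v p → ⇔-id _ ; (suc _) v p → mk⇔ (λ v∈ → ⊥-elim (avoids v v∈ p)) (λ ()) }))
    Y′~W : Y′ ~ W
    Y′~W = to (E-form⇔ {u} dY′ dW) (composition E-form
      (outside refl refl (at du) (at du) (λ _ → inj₁ (⊑-refl , ⊑-refl))
        (λ { zero → out ; (suc _) v _ → ⇔-id _ }))
      -- The second argument is first emptied, then `Y` becomes `Y′`, then `W` is restored.
      (Agree-trans t (rest Y) (Agree-trans t holds (Agree-sym t (rest Y′))))
      (from (E-form⇔ {u} (proj₂ (E-dom X~Y)) dW) (E-trans (E-sym X~Y) X~W)))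

  -- Needed nodes, infinite subtrees and the frontier

  Needed-⊑ : ∀ {X v w} → v ⊑ w → Needed X w → Needed X v
  Needed-⊑ p h W dW e with h W dW e
  ... | y , dy , y∈ , q = y , dy , y∈ , ⊑-trans p q

  Needed-resp : ∀ {X Y v} → X ~ Y → Needed X v → Needed Y v
  Needed-resp X~Y h W dW e = h W dW (E-trans X~Y e)

  Needed-length : ∀ {X n v} → X ~ X → Fits X n → Needed X v → length v ≤ n
  Needed-length X~X X≤n h with h _ (proj₁ (E-dom X~X)) X~X
  ... | w , _ , w∈ , p = ≤-trans (Prefix.length-mono p) (X≤n w w∈)

  Infinite-dom : ∀ {v} → Infinite v → InDom t v
  Infinite-dom h with h [] []
  ... | y , dy , p , _ = InDom-⊑ t p dy

  Infinite-⊑ : ∀ {v w} → v ⊑ w → Infinite w → Infinite v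
  Infinite-⊑ p h X dX with h X dX
  ... | y , dy , q , y∉ = y , dy , ⊑-trans p q , y∉

  Infinite-unbounded : ∀ {v} → Infinite v → ∀ n → Σ Node λ y → InDom t y × v ⊑ y × n ≤ length y
  Infinite-unbounded h n with comprehension (λ y → InDom t y × length y ≤ n) n (λ _ → proj₂)
  ... | X , X⇔ with h X (All.tabulate λ y∈ → proj₁ (to (X⇔ _) y∈))
  ...   | y , dy , p , y∉ = y , dy , p , <⇒≤ (≰⇒> λ y≤n → y∉ (from (X⇔ y) (dy , y≤n)))

  ¬Infinite-bounded : ∀ {v} → ¬ Infinite v → Σ ℕ λ n → ∀ y → InDom t y → v ⊑ y → length y ≤ n
  ¬Infinite-bounded ¬inf with ¬∀⇒∃¬ ¬inf
  ... | X , h with fits X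
  ...   | n , X≤n = n , λ y dy p → X≤n y (stable λ y∉ →
          h λ _ → y , dy , p , y∉)

  -- A step of König's lemma: depth bounds for both children would bound the whole subtree.
  Infinite-child : ∀ {v} → Infinite v → Σ Bool λ b → Infinite (child v b)
  Infinite-child {v} h with em {Infinite (child v false)} | em {Infinite (child v true)}
  ... | yes i | _     = false , i
  ... | no _  | yes i = true , i
  ... | no f  | no g  with ¬Infinite-bounded f | ¬Infinite-bounded g
  ...   | n , ≤n | m , ≤m with Infinite-unbounded h (suc (length v ⊔ (n ⊔ m)))
  ...     | y , dy , p , long with ⊑-next p
  ...       | inj₁ refl        = ⊥-elim (<⇒≱ long (m≤m⊔n (length v) _))
  ...       | inj₂ (false , q) = ⊥-elim (<⇒≱ long (≤-trans (≤n y dy q)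
                (≤-trans (m≤m⊔n n m) (m≤n⊔m (length v) _))))
  ...       | inj₂ (true , q)  = ⊥-elim (<⇒≱ long (≤-trans (≤m y dy q)
                (≤-trans (m≤n⊔m n m) (m≤n⊔m (length v) _))))

  -- An infinite subtree has arbitrarily deep nodes, and such a node is cut off at the level in
  -- question.
  Level-inhabited : ∀ {u} → Infinite u → ∀ i → Σ Node λ y → InDom t y × Level i u y
  Level-inhabited {u} h i with Infinite-unbounded h (i + length u)
  ... | y , dy , p , long with interval p (m≤n+m (length u) i) long
  ...   | w , q , r , e = w , InDom-⊑ t r dy , q , e

  Frontier-below : ∀ {X v} → Infinite v → ¬ Needed X v → Σ Node λ u → u ⊑ v × Frontier X u
  Frontier-below {X} = go (reverseView _)
    where
    go : ∀ {v} → Reverse v → Infinite v → ¬ Needed X v → Σ Node λ u → u ⊑ v × Frontier X u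
    go [] inf ¬n = [] , ⊑-refl , inf , ¬n , λ { v _ [] v≢ → ⊥-elim (v≢ refl) }
    go (w ∶ rs ∶ʳ b) inf ¬n with em {Needed X w}
    ... | yes n = child w b , ⊑-refl , inf , ¬n , λ v _ p v≢ →
            [ (λ q → Needed-⊑ q n) , ⊥-elim ∘ v≢ ]′ (⊑-child⁻ w p)
    ... | no ¬n′ with go rs (Infinite-⊑ (⊑-child w b) inf) ¬n′
    ...   | u , p , fr = u , ⊑-trans p (⊑-child w b) , fr

  Frontier-antichain : ∀ {X u v y} → Frontier X u → Frontier X v → u ⊑ y → v ⊑ y → u ≡ v
  Frontier-antichain {u = u} {v} (i , ¬n , h) (i′ , ¬n′ , h′) p q with ⊑-compare p q
  ... | inj₁ r = stable λ u≢v → ¬n (h′ u (Infinite-dom i) r u≢v)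
  ... | inj₂ r = stable λ u≢v → ¬n′ (h v (Infinite-dom i′) r (u≢v ∘ sym))

  -- Descend through infinite children. Needed nodes have length at most `n`, so an unneeded child
  -- is met, and the first one is in the frontier. The counter `c` with `n < c + length z` ensures
  -- termination.
  Frontier-above : ∀ {X z} → X ~ X → Needed X z → Infinite z →
                   Σ Node λ u → Frontier X u × z ⊑ u × length z < length u
  Frontier-above {X} X~X nz iz with fits X
  ... | n , X≤n = go (suc n) nz iz (s≤s (m≤m+n n _))
    where
    go : ∀ {z} c → Needed X z → Infinite z → n < c + length z →
         Σ Node λ u → Frontier X u × z ⊑ u × length z < length u
    go zero nz iz n<z = ⊥-elim (<⇒≱ n<z (Needed-length X~X X≤n nz))
    go {z} (suc c) nz iz n<z with Infinite-child iz
    ... | b , ib with em {Needed X (child z b)}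
    ...   | no ¬n = child z b ,
            (ib , ¬n , λ v _ p v≢ → [ (λ q → Needed-⊑ q nz) , ⊥-elim ∘ v≢ ]′ (⊑-child⁻ z p)) ,
            ⊑-child z b , ≤-reflexive (sym (length-child z b))
    ...   | yes nb with go c nb ib (subst (n <_) (trans (sym (+-suc c (length z)))
                          (cong (c +_) (sym (length-child z b)))) n<z)
    ...     | u , fr , p , l = u , fr , ⊑-trans (⊑-child z b) p ,
              ≤-trans (s≤s (Prefix.length-mono (⊑-child z b))) l

  -- The parent of a frontier node is needed, hence of length at most `n`.
  Frontier-length : ∀ {X n u} → X ~ X → Fits X n → Frontier X u → length u ≤ suc n
  Frontier-length {X} {n} X~X X≤n = go (reverseView _)
    where
    go : ∀ {u} → Reverse u → Frontier X u → length u ≤ suc n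
    go [] _ = z≤n
    go (w ∶ _ ∶ʳ b) (i , _ , h) = subst (_≤ suc n) (sym (length-child w b))
      (s≤s (Needed-length X~X X≤n (h w (InDom-⊑ t (⊑-child w b) (Infinite-dom i)) (⊑-child w b)
        λ e → 1+n≢n (trans (sym (length-child w b)) (cong length (sym e))))))

  -- Recovering a class from a code

  Mark-level : ∀ l {i X u y} → Mark l i X u y →
               u ⊑ y × i + length u ≤ length y × length y ≤ (length l + i) + length u
  Mark-level []      (p , e) = p , ≤-reflexive (sym e) , ≤-reflexive e
  Mark-level (ψ ∷ l) {i} {u = u} (inj₁ ((p , e) , _)) =
    p , ≤-reflexive (sym e) , ≤-trans (≤-reflexive e) (+-monoˡ-≤ (length u) (m≤n+m i (suc (length l))))
  Mark-level (ψ ∷ l) {i} {u = u} {y} (inj₂ m) with Mark-level l m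
  ... | p , lo , hi = p , ≤-trans (n≤1+n _) lo ,
    subst (λ j → length y ≤ j + length u) (+-suc (length l) i) hi

  Mark-end : ∀ l {i X u y} → Level (length l + i) u y → Mark l i X u y
  Mark-end []      h = h
  Mark-end (ψ ∷ l) {i} {u = u} {y} (p , e) =
    inj₂ (Mark-end l (p , trans e (cong (_+ length u) (sym (+-suc (length l) i)))))

  -- A stored truth value can be read off: its level is inhabited, and the marks of later formulas
  -- lie strictly deeper.
  Mark-Holds : ∀ l {i X Y u} → Infinite u →
               (∀ y → InDom t y → Mark l i X u y → Mark l i Y u y) →
               ∀ ψ → ψ ∈ l → Holds ψ X u → Holds ψ Y u
  Mark-Holds (ψ ∷ l) {i} inf h ψ (here refl) holds with Level-inhabited inf i
  ... | y , dy , lev with h y dy (inj₁ (lev , holds))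
  ...   | inj₁ (_ , holds′) = holds′
  ...   | inj₂ m = ⊥-elim (1+n≰n (≤-trans (proj₁ (proj₂ (Mark-level l m))) (≤-reflexive (proj₂ lev))))
  Mark-Holds (χ ∷ l) {i} {X} {Y} {u} inf h ψ (there ψ∈) = Mark-Holds l inf rest ψ ψ∈
    where
    rest : ∀ y → InDom t y → Mark l (suc i) X u y → Mark l (suc i) Y u y
    rest y dy m with h y dy (inj₂ m)
    ... | inj₂ m′ = m′
    ... | inj₁ ((_ , e) , _) =
      ⊥-elim (1+n≰n (≤-trans (proj₁ (proj₂ (Mark-level l m))) (≤-reflexive e)))

  -- Below a frontier node no element is copied from `X`, and no other frontier node has marks
  -- there, as the frontier is an antichain.
  Code-marks : ∀ {X U u y} → Code X U → Frontier X u → InDom t y → u ⊑ y →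
               y ∈ U ⇔ Mark E-tests 0 X u y
  Code-marks {X} {U} {u} {y} code fr dy p =
    mk⇔ (λ y∈ → forth (to (code y dy) y∈))
        (λ m → from (code y dy) (inj₂ (u , Infinite-dom (proj₁ fr) , fr , m)))
    where
    forth : _ → Mark E-tests 0 X u y
    forth (inj₁ (bounded , _)) = ⊥-elim (bounded (u , Infinite-dom (proj₁ fr) , fr , p))
    forth (inj₂ (v , _ , fr′ , m))
      with refl ← Frontier-antichain fr fr′ p (proj₁ (Mark-level E-tests m)) = m

  Code-bounded : ∀ {X U y} → Code X U → InDom t y → Bounded X y → y ∈ U ⇔ y ∈ X
  Code-bounded {X} {U} {y} code dy bounded =
    mk⇔ (λ y∈ → forth (to (code y dy) y∈)) (λ y∈ → from (code y dy) (inj₁ (bounded , y∈)))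
    where
    forth : _ → y ∈ X
    forth (inj₁ (_ , y∈)) = y∈
    forth (inj₂ (v , dv , fr , m)) = ⊥-elim (bounded (v , dv , fr , proj₁ (Mark-level E-tests m)))

  -- If z were needed for X but not for Y, a frontier node of X strictly below z would have its end
  -- marker too deep to be a mark of the frontier node of Y above z.
  Code-Needed : ∀ {X Y U z} → X ~ X → Code X U → Code Y U → Infinite z → Needed X z → Needed Y z
  Code-Needed {X} {Y} {U} {z} X~X codeX codeY iz nz = stable λ ¬n → absurd (Frontier-below iz ¬n)
    where
    absurd : ¬ Σ Node λ v → v ⊑ z × Frontier Y v
    absurd (v , v⊑z , frv) with Frontier-above X~X nz iz
    ... | u , fru , z⊑u , z<u with Level-inhabited (proj₁ fru) (length E-tests + 0)
    ...   | y , dy , lev@(u⊑y , e) =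
      <⇒≱ (≤-trans (s≤s (Prefix.length-mono v⊑z)) z<u)
        (+-cancelˡ-≤ (length E-tests + 0) _ _
          (≤-trans (≤-reflexive (sym e)) (proj₂ (proj₂ (Mark-level E-tests
            (to (Code-marks codeY frv dy (⊑-trans v⊑z (⊑-trans z⊑u u⊑y)))
              (from (Code-marks codeX fru dy u⊑y) (Mark-end E-tests lev))))))))

  Code-Frontier : ∀ {X Y U u} → X ~ X → Y ~ Y → Code X U → Code Y U → Frontier X u → Frontier Y u
  Code-Frontier X~X Y~Y codeX codeY (i , ¬n , h) =
    i , ¬n ∘ Code-Needed Y~Y codeY codeX i ,
    λ v dv p v≢ → Code-Needed X~X codeX codeY (Infinite-⊑ p i) (h v dv p v≢)

  -- Turns `X′` into `Y` by one `swap` for each frontier node in `us`. The frontier is an antichain,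
  -- so an exchange below one node leaves the tests at the others intact.
  hybrid : ∀ {X Y} us → (∀ u → u ∈ us → Frontier X u) → ∀ X′ → X ~ X′ → All (InDom t) Y →
           (∀ u → Frontier X u → ∀ ψ → ψ ∈ E-tests → Holds ψ X′ u ⇔ Holds ψ Y u) →
           (∀ v → (∀ u → u ∈ us → ¬ u ⊑ v) → v ∈ X′ ⇔ v ∈ Y) → X ~ Y
  hybrid [] _ X′ X~X′ dY holds out = ~-ext X~X′ dY λ v → out v λ _ ()
  hybrid {X} {Y} (u ∷ us) frs X′ X~X′ dY holds out with Below.replace-below t u X′ Y
  ... | X″ , in-Y , out-X′ , dX″ = hybrid us (λ v v∈ → frs v (there v∈)) X″
    (swap X~X′ (Infinite-dom (proj₁ fru)) (proj₁ (proj₂ fru)) (dX″ (proj₂ (E-dom X~X′)) dY) out-X′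
      (λ ψ ψ∈ → at-u ψ ψ∈ ⇔-∘ holds u fru ψ ψ∈))
    dY holds″ out″
    where
    fru : Frontier X u
    fru = frs u (here refl)
    same-below : ∀ {v V W} → InDom t v → (∀ y → v ⊑ y → y ∈ V ⇔ y ∈ W) →
                 ∀ ψ → ψ ∈ E-tests → Holds ψ V v ⇔ Holds ψ W v
    same-below {v} dv s = Inside⇒Agree E-form
      (inside refl refl (at dv) (at dv) (λ _ → inj₁ (⊑-refl , refl))
        (λ { zero → s ; (suc _) _ _ → ⇔-id _ }))
      where open Below t v
    at-u : ∀ ψ → ψ ∈ E-tests → Holds ψ Y u ⇔ Holds ψ X″ u
    at-u = same-below (Infinite-dom (proj₁ fru)) in-Y
    holds″ : ∀ v → Frontier X v → ∀ ψ → ψ ∈ E-tests → Holds ψ X″ v ⇔ Holds ψ Y v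
    holds″ v frv ψ ψ∈ with em {u ≡ v}
    ... | yes refl = ⇔-sym (at-u ψ ψ∈)
    ... | no u≢v = holds v frv ψ ψ∈ ⇔-∘ same-below (Infinite-dom (proj₁ frv))
            (λ y p → ⇔-sym (out-X′ y λ q → u≢v (Frontier-antichain fru frv q p))) ψ ψ∈
    out″ : ∀ v → (∀ w → w ∈ us → ¬ w ⊑ v) → v ∈ X″ ⇔ v ∈ Y
    out″ v h with em {u ⊑ v}
    ... | yes p = ⇔-sym (in-Y v p)
    ... | no ¬p = out v (λ { w (here refl) → ¬p ; w (there w∈) → h w w∈ }) ⇔-∘ ⇔-sym (out-X′ v ¬p)

  -- A common code forces equal frontiers. Its marks then give equal test values at each frontier
  -- node, and elsewhere it coincides with both sets, so `hybrid` applies.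
  Code-injective : ∀ {X Y U} → X ~ X → Y ~ Y → Code X U → Code Y U → X ~ Y
  Code-injective {X} {Y} {U} X~X Y~Y codeX codeY with fits X
  ... | n , X≤n with comprehension (Frontier X) (suc n) (λ _ → Frontier-length X~X X≤n)
  ...   | us , us⇔ = hybrid us (λ u → to (us⇔ u)) X X~X dY
    (λ u fr ψ ψ∈ → mk⇔
      (Mark-Holds E-tests (proj₁ fr) (λ y dy m → to (marks fr dy (proj₁ (Mark-level E-tests m))) m) ψ ψ∈)
      (Mark-Holds E-tests (proj₁ fr) (λ y dy m → from (marks fr dy (proj₁ (Mark-level E-tests m))) m) ψ ψ∈))
    (λ v h → mk⇔ (λ v∈ → to (rest (All.lookup dX v∈) h) v∈) (λ v∈ → from (rest (All.lookup dY v∈) h) v∈))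
    where
    dX : All (InDom t) X
    dX = proj₁ (E-dom X~X)
    dY : All (InDom t) Y
    dY = proj₁ (E-dom Y~Y)
    X⇒Y : ∀ {u} → Frontier X u → Frontier Y u
    X⇒Y = Code-Frontier X~X Y~Y codeX codeY
    marks : ∀ {u y} → Frontier X u → InDom t y → u ⊑ y → Mark E-tests 0 X u y ⇔ Mark E-tests 0 Y u y
    marks fr dy p = Code-marks codeY (X⇒Y fr) dy p ⇔-∘ ⇔-sym (Code-marks codeX fr dy p)
    rest : ∀ {v} → InDom t v → (∀ u → u ∈ us → ¬ u ⊑ v) → v ∈ X ⇔ v ∈ Y
    rest {v} dv h = Code-bounded codeY dv
        (λ (u , du , fr , p) → h u (from (us⇔ u) (Code-Frontier Y~Y X~X codeY codeX fr)) p)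
      ⇔-∘ ⇔-sym (Code-bounded codeX dv λ (u , _ , fr , p) → h u (from (us⇔ u) fr) p)

  -- Existence and depth of codes

  Code-exists : ∀ {X} → X ~ X → Σ (List Node) λ U → All (InDom t) U × Code X U
  Code-exists {X} X~X with fits X
  ... | n , X≤n = proj₁ U , All.tabulate (λ y∈ → proj₁ (to (proj₂ U _) y∈)) ,
    λ y dy → mk⇔ (λ y∈ → proj₂ (to (proj₂ U y) y∈)) (λ h → from (proj₂ U y) (dy , h))
    where
    Content : Node → Set
    Content y = InDom t y × ((Bounded X y × y ∈ X) ⊎
      Σ Node λ u → InDom t u × Frontier X u × Mark E-tests 0 X u y)
    -- The deepest possible mark is the end marker below a frontier node of length `suc n`.
    short : ∀ y → Content y → length y ≤ n ⊔ ((length E-tests + 0) + suc n)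
    short y (_ , inj₁ (_ , y∈)) = ≤-trans (X≤n y y∈) (m≤m⊔n n _)
    short y (_ , inj₂ (u , _ , fr , m)) = ≤-trans (proj₂ (proj₂ (Mark-level E-tests m)))
      (≤-trans (+-monoʳ-≤ (length E-tests + 0) (Frontier-length X~X X≤n fr)) (m≤n⊔m n _))
    U : Σ (List Node) λ U → ∀ y → y ∈ U ⇔ Content y
    U = comprehension Content _ short

  finite-subtrees : (l : List Node) → Σ ℕ λ n →
    ∀ v → v ∈ l → ¬ Infinite v → ∀ y → InDom t y → v ⊑ y → length y ≤ n
  finite-subtrees [] = 0 , λ _ ()
  finite-subtrees (u ∷ l) with finite-subtrees l | em {Infinite u}
  ... | n , h | yes i = n , λ { v (here refl) ¬i → ⊥-elim (¬i i) ; v (there v∈) → h v v∈ }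
  ... | n , h | no ¬i with ¬Infinite-bounded ¬i
  ...   | m , g = m ⊔ n , λ where
    v (here refl) _  y dy p → ≤-trans (g y dy p) (m≤m⊔n m n)
    v (there v∈)  ¬i y dy p → ≤-trans (h v v∈ ¬i y dy p) (m≤n⊔m m n)

  -- A longer bounded node has a prefix of length `suc n`, too long to be needed. Its subtree is
  -- finite, since otherwise a frontier node would be a prefix of it. There are finitely many such
  -- prefixes, so one depth bound serves for all.
  Bounded-length : ∀ {X} → X ~ X → Σ ℕ λ n → ∀ y → InDom t y → Bounded X y → length y ≤ n
  Bounded-length {X} X~X with fits X
  ... | n , X≤n with finite-subtrees (words (suc n))
  ...   | m , h = n ⊔ m , bound
    where
    bound : ∀ y → InDom t y → Bounded X y → length y ≤ n ⊔ m
    bound y dy bounded with ≤-total (length y) n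
    ... | inj₁ y≤n = ≤-trans y≤n (m≤m⊔n n m)
    ... | inj₂ n≤y with em {length y ≤ n}
    ...   | yes y≤n = ≤-trans y≤n (m≤m⊔n n m)
    ...   | no y≰n with prefix-of-length (≰⇒> y≰n)
    ...     | v , p , e = ≤-trans (h v (∈-words (suc n) v (≤-reflexive e)) finite y dy p) (m≤n⊔m n m)
      where
      unneeded : ¬ Needed X v
      unneeded nv = 1+n≰n (≤-trans (≤-reflexive (sym e)) (Needed-length X~X X≤n nv))
      finite : ¬ Infinite v
      finite i with Frontier-below i unneeded
      ... | u , q , fr = bounded (u , Infinite-dom (proj₁ fr) , fr , ⊑-trans q p)

  Frontier-resp : ∀ {X Y u} → X ~ Y → Frontier X u → Frontier Y u
  Frontier-resp X~Y (i , ¬n , h) =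
    i , ¬n ∘ Needed-resp (E-sym X~Y) , λ v dv p v≢ → Needed-resp X~Y (h v dv p v≢)

  -- The frontier depends on the class alone. Bounds obtained from `X` thus hold for the codes of
  -- all members, however deep the members are.
  CodeOfClass-fits : ∀ {X} → X ~ X → Σ ℕ λ n → ∀ U → All (InDom t) U → CodeOfClass X U → Fits U n
  CodeOfClass-fits {X} X~X with fits X | Bounded-length X~X
  ... | n , X≤n | m , h = m ⊔ ((length E-tests + 0) + suc n) , bound
    where
    bound : ∀ U → All (InDom t) U → CodeOfClass X U → Fits U (m ⊔ ((length E-tests + 0) + suc n))
    bound U dU (X′ , _ , X~X′ , code) y y∈ with to (code y (All.lookup dU y∈)) y∈
    ... | inj₁ (bounded , _) = ≤-trans
            (h y (All.lookup dU y∈) λ (u , du , fr , p) → bounded (u , du , Frontier-resp X~X′ fr , p))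
            (m≤m⊔n m _)
    ... | inj₂ (u , _ , fr , mark) = ≤-trans (proj₂ (proj₂ (Mark-level E-tests mark)))
            (≤-trans (+-monoʳ-≤ (length E-tests + 0)
                        (Frontier-length X~X X≤n (Frontier-resp (E-sym X~X′) fr)))
                     (m≤n⊔m m _))

  -- Canonical codes

  Canonical-exists : ∀ {X} → X ~ X → Σ (List Node) λ U → All (InDom t) U × Canonical X U
  Canonical-exists {X} X~X with Code-exists X~X | CodeOfClass-fits X~X
  ... | U₀ , dU₀ , code | n , short
      with lex-minimum (λ U → All (InDom t) U × CodeOfClass X U) (words n) (words-sorted n) U₀
             (dU₀ , X , proj₁ (E-dom X~X) , X~X , code)
  ...   | U , (dU , codeU) , least = U , dU , codeU , compare
    where
    everywhere : ∀ V → All (InDom t) V → CodeOfClass X V → ∀ z →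
                 (z ∈ words n → z ∈ U ⇔ z ∈ V) → z ∈ U ⇔ z ∈ V
    -- A node outside `words n` is too long to be in either code.
    everywhere V dV codeV z h = mk⇔
      (λ z∈ → to (h (∈-words n z (short U dU codeU z z∈))) z∈)
      (λ z∈ → from (h (∈-words n z (short V dV codeV z z∈))) z∈)
    compare : ∀ V → All (InDom t) V → CodeOfClass X V → Same U V ⊎ Less U V
    compare V dV codeV with least V (dV , codeV)
    ... | inj₁ same = inj₁ λ y _ → everywhere V dV codeV y (same y)
    ... | inj₂ (y , y∈V , y∉U , same) = inj₂ (y , All.lookup dV y∈V , y∈V , y∉U ,
            λ z _ z≺y → everywhere V dV codeV z λ z∈ → same z z∈ z≺y)

  Less-asym : ∀ {U V} → Less U V → ¬ Less V U
  Less-asym (y , dy , y∈V , y∉U , same) (z , dz , z∈U , z∉V , same′) with ≺-compare y z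
  ... | inj₁ y≺z         = y∉U (to (same′ y dy y≺z) y∈V)
  ... | inj₂ (inj₁ refl) = y∉U z∈U
  ... | inj₂ (inj₂ z≺y)  = z∉V (to (same z dz z≺y) z∈U)

  CodeOfClass-resp : ∀ {X Y U} → X ~ Y → CodeOfClass Y U → CodeOfClass X U
  CodeOfClass-resp X~Y (Y′ , dY′ , Y~Y′ , code) = Y′ , dY′ , E-trans X~Y Y~Y′ , code

  -- Equivalent sets have the same candidate codes, so each minimum is compared with the other.
  Canonical-unique : ∀ {X Y U V} → X ~ Y → All (InDom t) U → All (InDom t) V →
                     Canonical X U → Canonical Y V → Same U V
  Canonical-unique X~Y dU dV (codeU , leastU) (codeV , leastV)
    with leastU _ dV (CodeOfClass-resp X~Y codeV) | leastV _ dU (CodeOfClass-resp (E-sym X~Y) codeU)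
  ... | inj₁ same | _         = same
  ... | inj₂ _    | inj₁ same = λ y dy → ⇔-sym (same y dy)
  ... | inj₂ less | inj₂ more = ⊥-elim (Less-asym less more)

  Canonical-injective : ∀ {X Y U V} → Same U V → Canonical X U → Canonical Y V → X ~ Y
  Canonical-injective same ((X′ , _ , X~X′ , codeX) , _) ((Y′ , _ , Y~Y′ , codeY) , _) =
    E-trans X~X′ (E-trans
      (Code-injective (~-refl (E-sym X~X′)) (~-refl (E-sym Y~Y′)) codeX
        (λ y dy → codeY y dy ⇔-∘ same y dy))
      (E-sym Y~Y′))

-- The quotient interpretation

append : ∀ {A : Set} {n} a → (Fin a → A) → (Fin n → A) → Fin (a + n) → A
append zero    xs ys = ys
append (suc a) xs ys = xs zero VF.∷ append a (xs ∘ suc) ys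

append-↑ˡ : ∀ {A : Set} {n} a (xs : Fin a → A) (ys : Fin n → A) j → append a xs ys (j ↑ˡ n) ≡ xs j
append-↑ˡ (suc a) xs ys zero    = refl
append-↑ˡ (suc a) xs ys (suc j) = append-↑ˡ a (xs ∘ suc) ys j

append-↑ʳ : ∀ {A : Set} {n} a (xs : Fin a → A) (ys : Fin n → A) j → append a xs ys (a ↑ʳ j) ≡ ys j
append-↑ʳ zero    xs ys j = refl
append-↑ʳ (suc a) xs ys j = append-↑ʳ a (xs ∘ suc) ys j

module _ {sig : Sig} (A : Structure sig) (s : Fin (N sig)) (bin : ar sig s ≡ 2) (x y : Carrier A) where

  -- Unification with `refl` extracts the tuple that `BinRel` builds locally, so that it can be
  -- compared with `two x y`.
  BinRel-arguments : Σ (Fin (ar sig s) → Carrier A) λ xs → BinRel A s bin x y ≡ rel A s xs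
  BinRel-arguments = _ , refl

  BinRel-arguments-≡ : ∀ j → proj₁ BinRel-arguments j ≡ two x y (subst Fin bin j)
  BinRel-arguments-≡ j with subst Fin bin j
  ... | zero  = refl
  ... | suc _ = refl

module Quotients (em : ExcludedMiddle 0ℓ) {k : ℕ} {sig : Sig} (I : Interp k sig)
                 (s : Fin (N sig)) (bin : ar sig s ≡ 2) where
  open Definability em {k}

  -- The added quantifier goes innermost, since the head of `append` is the set bound last.
  d-exs : ∀ a {m n} {P : Predicate k m (a + n)} → Def P → Def {k} {m} {n}
          (λ t ρ σ → Σ (Fin a → List Node) λ Xs → (∀ j → All (InDom t) (Xs j)) × P t ρ (append a Xs σ))
  d-exs zero    p = d-map (λ _ → mk⇔ (λ h → none , (λ ()) , h) (λ (_ , _ , h) → h)) p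
  d-exs (suc a) {P = P} p = d-map
    {P = λ t ρ σ → Σ (Fin a → List Node) λ Xs → (∀ j → All (InDom t) (Xs j)) ×
      Σ (List Node) λ X → All (InDom t) X × P t ρ (X VF.∷ append a Xs σ)}
    (λ _ → mk⇔
      (λ (Xs , dXs , X , dX , h) → X VF.∷ Xs , (λ { zero → dX ; (suc j) → dXs j }) , h)
      (λ (Xs , dXs , h) → Xs ∘ suc , dXs ∘ suc , Xs zero , dXs zero , h))
    (d-exs a (d-ex2 p))

  d-closed : ∀ {n n′} (φ : Form k 0 n) (f : Fin n → Fin n′) →
             Def {k} {0} (λ t ρ σ → Sat φ t noFO (σ ∘ f))
  d-closed φ f = d-map (λ _ → Sat-cong φ (λ ()) (λ _ _ → ⇔-id _)) (d-ren none f (d-sat φ))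

  Universe : Tree k → List Node → Set
  Universe t X = Sat (δ I) t noFO (at X)

  -- The domain and universe conditions make this a partial equivalence on all lists, whereas the
  -- congruence speaks of elements of the structure.
  E : Tree k → List Node → List Node → Set
  E t X Y = (All (InDom t) X × All (InDom t) Y) × (Universe t X × Universe t Y) ×
    Sat (Φ I s) t noFO (two X Y ∘ subst Fin bin)

  d-E : Def {k} {0} {2} (λ t ρ σ → E t (σ zero) (σ (suc zero)))
  d-E = d-map
    (λ {t} {ρ} {σ} d → mk⇔
      (λ (u , r) → (Env.sets d zero , Env.sets d (suc zero)) , u , to (pair t σ) r)
      (λ (_ , u , r) → u , from (pair t σ) r))
    (d-and (d-and (d-closed (δ I) (at zero)) (d-closed (δ I) (at (suc zero))))
           (d-closed (Φ I s) (subst Fin bin)))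
    where
    pair : ∀ t (σ : Fin 2 → List Node) → Sat (Φ I s) t noFO (σ ∘ subst Fin bin) ⇔
           Sat (Φ I s) t noFO (two (σ zero) (σ (suc zero)) ∘ subst Fin bin)
    pair t σ = Sat-cong (Φ I s) (λ ()) λ j v → η (subst Fin bin j) v
      where
      η : ∀ j v → v ∈ σ j ⇔ v ∈ two (σ zero) (σ (suc zero)) j
      η zero       v = ⇔-id _
      η (suc zero) v = ⇔-id _

  open Coding em E d-E using (module Codes; d-Canonical)
  open Codes using (Canonical; Same)

  Represents : Tree k → List Node → List Node → Set
  Represents t X U = Universe t X × Canonical t X U

  d-Represents : ∀ {n} (X U : Fin n) → Def {k} {0} (λ t ρ σ → Represents t (σ X) (σ U))
  d-Represents X U = d-and (d-closed (δ I) (at X)) (d-ren none (two X U) d-Canonical)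

  d-universe : Def {k} {0} {1} (λ t ρ σ →
    Σ (List Node) λ X → All (InDom t) X × Represents t X (σ zero))
  d-universe = d-ex2 (d-Represents zero (suc zero))

  -- The relation passes to codes through a choice of represented sets, as in a quotient.
  Image : Tree k → (i : Fin (N sig)) → (Fin (ar sig i) → List Node) → Set
  Image t i Us = Σ (Fin (ar sig i) → List Node) λ Xs → (∀ j → All (InDom t) (Xs j)) ×
    (∀ j → Represents t (Xs j) (Us j)) × Sat (Φ I i) t noFO Xs

  d-image : ∀ i → Def {k} {0} (λ t ρ σ → Image t i σ)
  d-image i = d-map
    {P = λ t ρ σ → Σ (Fin n → List Node) λ Xs → (∀ j → All (InDom t) (Xs j)) ×
      (∀ j → Represents t (append n Xs σ (j ↑ˡ n)) (append n Xs σ (n ↑ʳ j))) ×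
      Sat (Φ I i) t noFO (append n Xs σ ∘ (_↑ˡ n))}
    (λ {t} {ρ} {σ} _ → mk⇔
      (λ (Xs , dXs , r , h) → Xs , dXs ,
        (λ j → subst₂ (Represents t) (append-↑ˡ n Xs σ j) (append-↑ʳ n Xs σ j) (r j)) ,
        to (body t Xs σ) h)
      (λ (Xs , dXs , r , h) → Xs , dXs ,
        (λ j → subst₂ (Represents t) (sym (append-↑ˡ n Xs σ j)) (sym (append-↑ʳ n Xs σ j)) (r j)) ,
        from (body t Xs σ) h))
    (d-exs n (d-and (d-all λ j → d-Represents (j ↑ˡ n) (n ↑ʳ j)) (d-closed (Φ I i) (_↑ˡ n))))
    where
    n = ar sig i
    body : ∀ t Xs σ → Sat (Φ I i) t noFO (append n Xs σ ∘ (_↑ˡ n)) ⇔ Sat (Φ I i) t noFO Xs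
    body t Xs σ = Sat-cong (Φ I i) (λ ()) λ j v →
      mk⇔ (subst (v ∈_) (append-↑ˡ n Xs σ j)) (subst (v ∈_) (sym (append-↑ˡ n Xs σ j)))

  quotient : Interp k sig
  quotient = record { δ = Def.form d-universe ; Φ = λ i → Def.form (d-image i) }

  module _ (t : Tree k) (cong-E : IsCongruence (⟦ I ⟧ t) (BinRel (⟦ I ⟧ t) s bin)) where
    private
      A A′ : Structure sig
      A  = ⟦ I ⟧ t
      A′ = ⟦ quotient ⟧ t

      R : Carrier A → Carrier A → Set
      R = BinRel A s bin

      module R = IsEquivalence (IsCongruence.isEquivalence cong-E)

      set : Carrier A → List Node
      set = proj₁ ∘ proj₁

      set′ : Carrier A′ → List Node
      set′ = proj₁ ∘ proj₁

    E⇔R : ∀ x y → E t (set x) (set y) ⇔ R x y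
    E⇔R x@((X , dX) , uX) y@((Y , dY) , uY) =
      mk⇔ (λ (_ , _ , r) → to pair r) (λ r → (dX , dY) , (uX , uY) , from pair r)
      where
      pair : Sat (Φ I s) t noFO (two X Y ∘ subst Fin bin) ⇔ R x y
      pair = Sat-cong (Φ I s) (λ ()) λ j v → same v (subst Fin bin j) (BinRel-arguments-≡ A s bin x y j)
        where
        same : ∀ {z} v i → z ≡ two x y i → v ∈ two X Y i ⇔ v ∈ set z
        same v zero    refl = ⇔-id _
        same v (suc _) refl = ⇔-id _

    element : ∀ {X} → All (InDom t) X → Universe t X → Carrier A
    element dX uX = (_ , dX) , uX

    E-sym : ∀ {X Y} → E t X Y → E t Y X
    E-sym e@((dX , dY) , (uX , uY) , _) =
      from (E⇔R (element dY uY) (element dX uX)) (R.sym (to (E⇔R (element dX uX) (element dY uY)) e))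

    E-trans : ∀ {X Y W} → E t X Y → E t Y W → E t X W
    E-trans e@((dX , dY) , (uX , uY) , _) e′@((_ , dW) , (_ , uW) , _) =
      from (E⇔R (element dX uX) (element dW uW))
        (R.trans (to (E⇔R (element dX uX) (element dY uY)) e)
                 (to (E⇔R (element dY uY) (element dW uW)) e′))

    open Classes em E d-E t proj₁ E-sym E-trans

    E-refl : ∀ x → E t (set x) (set x)
    E-refl x = from (E⇔R x x) R.refl

    env₀ : ∀ {n} {σ : Fin n → List Node} → (∀ j → All (InDom t) (σ j)) → Env t noFO σ
    env₀ = env λ ()

    decode : (V : Carrier A′) → Σ (List Node) λ X → All (InDom t) X × Represents t X (set′ V)
    decode ((U , dU) , h) = to (Def.spec d-universe (env₀ λ _ → dU)) h

    decoded : Carrier A′ → Carrier A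
    decoded V = element (proj₁ (proj₂ (decode V))) (proj₁ (proj₂ (proj₂ (decode V))))

    decoded-Canonical : ∀ V → Canonical t (set (decoded V)) (set′ V)
    decoded-Canonical V = proj₂ (proj₂ (proj₂ (decode V)))

    encode : (x : Carrier A) → Σ (List Node) λ U → All (InDom t) U × Canonical t (set x) U
    encode x = Canonical-exists (E-refl x)

    encoded : Carrier A → Carrier A′
    encoded x@((X , dX) , uX) = (proj₁ (encode x) , dU) ,
      from (Def.spec d-universe (env₀ λ _ → dU)) (X , dX , uX , proj₂ (proj₂ (encode x)))
      where dU = proj₁ (proj₂ (encode x))

    encoded-Canonical : ∀ x → Canonical t (set x) (set′ (encoded x))
    encoded-Canonical x = proj₂ (proj₂ (encode x))

    Same⇒≈ : ∀ V W → Same t (set′ V) (set′ W) → _≈_ A′ V W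
    Same⇒≈ ((_ , dV) , _) ((_ , dW) , _) same v = mk⇔
      (λ v∈ → to (same v (All.lookup dV v∈)) v∈) (λ v∈ → from (same v (All.lookup dW v∈)) v∈)

    -- A code goes to a set that it represents, a set to its canonical code. `Canonical-injective`
    -- and `Canonical-unique` make the maps well defined and mutually inverse.
    quotient-iso : Iso A′ (Quotient A R)
    quotient-iso = record
      { to        = decoded
      ; from      = encoded
      ; to-cong   = λ {V} {W} V≈W → to (E⇔R (decoded V) (decoded W))
          (Canonical-injective (λ v _ → V≈W v) (decoded-Canonical V) (decoded-Canonical W))
      ; from-cong = λ {x} {y} xRy → same-code (encoded x) (encoded y) (from (E⇔R x y) xRy)
          (encoded-Canonical x) (encoded-Canonical y)
      ; from-to   = λ V → same-code (encoded (decoded V)) V (E-refl (decoded V))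
          (encoded-Canonical (decoded V)) (decoded-Canonical V)
      ; to-from   = λ x → to (E⇔R (decoded (encoded x)) x)
          (Canonical-injective (λ _ _ → ⇔-id _) (decoded-Canonical (encoded x)) (encoded-Canonical x))
      ; rel-iso   = λ i Vs → mk⇔
          (λ h → forth i Vs (to (image i Vs) h))
          (λ (ys , ysRVs , r) → from (image i Vs)
            ( (λ j → set (decoded (Vs j)))
            , (λ j → proj₁ (proj₂ (decode (Vs j))))
            , (λ j → proj₂ (proj₂ (decode (Vs j))))
            -- Compatibility transports the relation from `ys` to the decoded sets, which witness
            -- `Image`.
            , to (IsCongruence.compatible cong-E i ys (decoded ∘ Vs) ysRVs) r))
      }
      where
      same-code : ∀ V W {X Y} → E t X Y → Canonical t X (set′ V) → Canonical t Y (set′ W) → _≈_ A′ V W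
      same-code V W e c c′ = Same⇒≈ V W (Canonical-unique e (proj₂ (proj₁ V)) (proj₂ (proj₁ W)) c c′)
      image : ∀ i (Vs : Fin (ar sig i) → Carrier A′) → rel A′ i Vs ⇔ Image t i (set′ ∘ Vs)
      image i Vs = Def.spec (d-image i) (env₀ λ j → proj₂ (proj₁ (Vs j)))
      forth : ∀ i Vs → Image t i (set′ ∘ Vs) → rel (Quotient A R) i (decoded ∘ Vs)
      forth i Vs (Xs , dXs , r , h) = ys ,
        -- The sets chosen in `Image` share their codes with the decoded ones, hence are equivalent
        -- to them.
        (λ j → to (E⇔R (ys j) (decoded (Vs j)))
          (Canonical-injective (λ _ _ → ⇔-id _) (proj₂ (r j)) (decoded-Canonical (Vs j)))) , h
        where
        ys : Fin (ar sig i) → Carrier A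
        ys j = element (dXs j) (proj₁ (r j))

theorem4p1 : ExcludedMiddle 0ℓ →
    ∀ {k : ℕ} {sig : Sig} (I : Interp k sig) (s : Fin (N sig)) (bin : ar sig s ≡ 2) →
    Σ (Interp k sig) λ I' →
    ∀ (t : Tree k) →
    IsCongruence (⟦ I ⟧ t) (BinRel (⟦ I ⟧ t) s bin) →
    Iso (⟦ I' ⟧ t) (Quotient (⟦ I ⟧ t) (BinRel (⟦ I ⟧ t) s bin))
theorem4p1 em I s bin = Quotients.quotient em I s bin , Quotients.quotient-iso em I s bin
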